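{- Let $f\in\mathbb{Z}[X]$ be a monic irreducible polynomial of degree $n\ge 2$, let $\theta$ be a root of $f$, let $K=\mathbb{Q}(\theta)$ with ring of integers $\mathcal{O}_K$, and let $\mathfrak{C}_\theta$ be the conductor of $\mathbb{Z}[\theta]$ in $\mathcal{O}_K$. Let $p$ be a prime number and let $r\in\mathbb{Z}$ satisfy: (i) $p^2\nmid f(r)$; (ii) $p\nmid f''(r)$; (iii) every maximal ideal $\mathfrak{m}$ of $\mathcal{O}_K$ with $\mathfrak{C}_\theta\subseteq\mathfrak{m}$ and $p\in\mathfrak{m}$ contains $\theta-r$. Then $\mathbb{Z}[\theta]$ is $p$-maximal.
   Context: The conductor of $\mathbb{Z}[\theta]$ is $\mathfrak{C}_\theta=\{x\in\mathcal{O}_K : x\mathcal{O}_K\subseteq\mathbb{Z}[\theta]\}$. For a prime $p$, the order $\mathbb{Z}[\theta]$ is called $p$-maximal if $p\nmid I(\theta)$, where $I(\theta)=[\mathcal{O}_K:\mathbb{Z}[\theta]]$ is the index. Here $f''$ is the formal second derivative of $f$. -}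

module Defs where

open import Algebra.Apartness.Bundles using (HeytingField)
open import Algebra.Bundles using (CommutativeRing)
open import Algebra.Bundles.Raw using (RawRing; RawSemiring)
open import Algebra.Morphism.Structures using (IsRingHomomorphism)
open import Data.Fin.Base using (Fin)
open import Data.Integer.Base as ℤ using (ℤ; +_; 0ℤ; 1ℤ)
import Data.Integer.Properties as ℤ
open import Data.List.Base using (List; []; _∷_; map)
open import Data.Nat.Base as ℕ using (ℕ; zero; suc; _<_)
open import Data.Nat.Divisibility using (_∣_)
open import Data.Product.Base using (Σ; ∃-syntax; _×_; _,_)
open import Data.Rational.Base as ℚ using (ℚ)
import Data.Rational.Properties as ℚ
open import Data.Rational.Literals using (fromℤ)
open import Function.Base using (id; _∘_)
open import Function.Bundles using (Bijection)
open import Level using (0ℓ; _⊔_) renaming (suc to lsuc)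
open import Relation.Binary.Bundles using (Setoid)
open import Relation.Binary.PropositionalEquality as ≡ using (_≡_)
open import Relation.Nullary.Negation using (¬_)
open import Relation.Unary using (Pred; _⊆_; _∈_)

-- Coefficient lists, constant term first.  Trailing zeros are allowed, so
-- equality of polynomials is _≈ₚ_ rather than _≡_.
ℤ[X] : Set
ℤ[X] = List ℤ

coeff : ℤ[X] → ℕ → ℤ
coeff []      _       = 0ℤ
coeff (a ∷ g) zero    = a
coeff (a ∷ g) (suc i) = coeff g i

infix  4 _≈ₚ_
infixl 6 _+ₚ_
infixl 7 _*ₚ_

_≈ₚ_ : ℤ[X] → ℤ[X] → Set
g ≈ₚ h = ∀ i → coeff g i ≡ coeff h i

_+ₚ_ : ℤ[X] → ℤ[X] → ℤ[X]
[]      +ₚ h       = h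
(a ∷ g) +ₚ []      = a ∷ g
(a ∷ g) +ₚ (b ∷ h) = (a ℤ.+ b) ∷ (g +ₚ h)

_*ₚ_ : ℤ[X] → ℤ[X] → ℤ[X]
[]      *ₚ h = []
(a ∷ g) *ₚ h = map (a ℤ.*_) h +ₚ (0ℤ ∷ (g *ₚ h))

ℤ[X]-rawSemiring : RawSemiring 0ℓ 0ℓ
ℤ[X]-rawSemiring = record
  { Carrier = ℤ[X] ; _≈_ = _≈ₚ_ ; _+_ = _+ₚ_ ; _*_ = _*ₚ_
  ; 0# = [] ; 1# = 1ℤ ∷ [] }

MonicOfDegree : ℕ → Pred ℤ[X] 0ℓ
MonicOfDegree n g = coeff g n ≡ 1ℤ × (∀ i → n < i → coeff g i ≡ 0ℤ)

-- weighted k (a₀ ∷ a₁ ∷ …) represents k a₀ + (k+1) a₁ X + ….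
weighted : ℕ → ℤ[X] → ℤ[X]
weighted k []      = []
weighted k (a ∷ g) = (+ k ℤ.* a) ∷ weighted (suc k) g

derivative : ℤ[X] → ℤ[X]
derivative []      = []
derivative (a ∷ g) = weighted 1 g

-- Evaluation in a ring R whose structure map is φ : ℤ → R.
module _ {c ℓ} (R : RawRing c ℓ) where

  open RawRing R

  evalIn : (ℤ → Carrier) → ℤ[X] → Carrier → Carrier
  evalIn φ []      x = 0#
  evalIn φ (a ∷ g) x = φ a + x * evalIn φ g x

evalℤ : ℤ[X] → ℤ → ℤ
evalℤ = evalIn ℤ.+-*-rawRing id

record ExtensionOfℚ c ℓ₁ ℓ₂ : Set (lsuc (c ⊔ ℓ₁ ⊔ ℓ₂)) where
  field
    field# : HeytingField c ℓ₁ ℓ₂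

  open HeytingField field# public

  commutativeRing : CommutativeRing c ℓ₁
  commutativeRing = record { isCommutativeRing = isCommutativeRing }

  open CommutativeRing commutativeRing public using (rawRing; ring)

  field
    ι                    : ℚ → Carrier
    ι-isRingHomomorphism : IsRingHomomorphism ℚ.+-*-rawRing rawRing ι

  fromInt : ℤ → Carrier
  fromInt = ι ∘ fromℤ

  eval : ℤ[X] → Carrier → Carrier
  eval = evalIn rawRing fromInt

module NumberField {c ℓ₁ ℓ₂} (E : ExtensionOfℚ c ℓ₁ ℓ₂)
                   (θ : ExtensionOfℚ.Carrier E) where

  open ExtensionOfℚ E

  -- ℚ(θ): the smallest subfield containing ℚ and θ.
  data K : Pred Carrier (c ⊔ ℓ₁) where
    rational  : ∀ q → ι q ∈ K
    generator : θ ∈ K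
    sum       : ∀ {x y} → x ∈ K → y ∈ K → x + y ∈ K
    negative  : ∀ {x} → x ∈ K → - x ∈ K
    product   : ∀ {x y} → x ∈ K → y ∈ K → x * y ∈ K
    inverse   : ∀ {x y} → x ∈ K → x * y ≈ 1# → y ∈ K
    respects  : ∀ {x y} → x ≈ y → x ∈ K → y ∈ K

  IsIntegral : Pred Carrier ℓ₁
  IsIntegral x = ∃[ d ] ∃[ g ] MonicOfDegree d g × eval g x ≈ 0#

  𝒪 : Pred Carrier (c ⊔ ℓ₁)
  𝒪 x = x ∈ K × IsIntegral x

  ℤ[θ] : Pred Carrier ℓ₁
  ℤ[θ] x = ∃[ g ] x ≈ eval g θ

  Conductor : Pred Carrier (c ⊔ ℓ₁)
  Conductor x = x ∈ 𝒪 × (∀ y → y ∈ 𝒪 → x * y ∈ ℤ[θ])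

  record IsIdeal (I : Pred Carrier (c ⊔ ℓ₁)) : Set (c ⊔ ℓ₁) where
    field
      ⊆𝒪       : I ⊆ 𝒪
      resp     : ∀ {x y} → x ≈ y → x ∈ I → y ∈ I
      0∈       : 0# ∈ I
      +-closed : ∀ {x y} → x ∈ I → y ∈ I → x + y ∈ I
      *-closed : ∀ {a x} → a ∈ 𝒪 → x ∈ I → a * x ∈ I

  -- Maximal elements of the poset of proper ideals.  The dichotomy
  -- "J = M or J = 𝒪" is avoided: J ranges over arbitrary predicates, so it
  -- would not be provable constructively of any M.
  record IsMaximalIdeal (M : Pred Carrier (c ⊔ ℓ₁)) : Set (lsuc (c ⊔ ℓ₁)) where
    field
      isIdeal : IsIdeal M
      proper  : ¬ (𝒪 ⊆ M)
      maximal : ∀ J → IsIdeal J → M ⊆ J → ¬ (𝒪 ⊆ J) → J ⊆ M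

  private
    open import Algebra.Properties.Ring ring
      using (-‿+-comm; -‿distribʳ-*; -0#≈0#; -‿involutive; ⁻¹-anti-homo‿-)
    open import Relation.Binary.Reasoning.Setoid setoid
    module ι = IsRingHomomorphism ι-isRingHomomorphism

    fromInt-+ : ∀ a b → fromInt (a ℤ.+ b) ≈ fromInt a + fromInt b
    fromInt-+ a b = trans (ι.⟦⟧-cong fromℤ-+) (ι.+-homo (fromℤ a) (fromℤ b))
      where
      fromℤ-+ : fromℤ (a ℤ.+ b) ≡ fromℤ a ℚ.+ fromℤ b
      fromℤ-+ = ≡.trans (≡.sym (ℚ.↥p/↧p≡p (fromℤ (a ℤ.+ b))))
        (≡.cong (ℚ._/ 1) (≡.sym (≡.cong₂ ℤ._+_ (ℤ.*-identityʳ a) (ℤ.*-identityʳ b))))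

    fromInt-neg : ∀ a → fromInt (ℤ.- a) ≈ - fromInt a
    fromInt-neg a = trans (ι.⟦⟧-cong (fromℤ-neg a)) (ι.-‿homo (fromℤ a))
      where
      fromℤ-neg : ∀ a → fromℤ (ℤ.- a) ≡ ℚ.- fromℤ a
      fromℤ-neg (+ zero)     = ≡.refl
      fromℤ-neg (+ suc _)    = ≡.refl
      fromℤ-neg (ℤ.-[1+ _ ]) = ≡.refl

    +-interchange : ∀ a b x y → (a + b) + (x + y) ≈ (a + x) + (b + y)
    +-interchange a b x y = begin
      (a + b) + (x + y) ≈⟨ +-assoc a b (x + y) ⟩
      a + (b + (x + y)) ≈⟨ +-congˡ (+-assoc b x y) ⟨
      a + ((b + x) + y) ≈⟨ +-congˡ (+-congʳ (+-comm b x)) ⟩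
      a + ((x + b) + y) ≈⟨ +-congˡ (+-assoc x b y) ⟩
      a + (x + (b + y)) ≈⟨ +-assoc a x (b + y) ⟨
      (a + x) + (b + y) ∎

    eval-+ : ∀ g h x → eval (g +ₚ h) x ≈ eval g x + eval h x
    eval-+ []      h       x = sym (+-identityˡ _)
    eval-+ (a ∷ g) []      x = sym (+-identityʳ _)
    eval-+ (a ∷ g) (b ∷ h) x = begin
      fromInt (a ℤ.+ b) + x * eval (g +ₚ h) x
        ≈⟨ +-cong (fromInt-+ a b) (*-congˡ (eval-+ g h x)) ⟩
      (fromInt a + fromInt b) + x * (eval g x + eval h x)
        ≈⟨ +-congˡ (distribˡ x _ _) ⟩
      (fromInt a + fromInt b) + (x * eval g x + x * eval h x)
        ≈⟨ +-interchange _ _ _ _ ⟩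
      (fromInt a + x * eval g x) + (fromInt b + x * eval h x) ∎

    eval-neg : ∀ g x → eval (map ℤ.-_ g) x ≈ - eval g x
    eval-neg []      x = sym -0#≈0#
    eval-neg (a ∷ g) x = begin
      fromInt (ℤ.- a) + x * eval (map ℤ.-_ g) x
        ≈⟨ +-cong (fromInt-neg a) (*-congˡ (eval-neg g x)) ⟩
      - fromInt a + x * - eval g x      ≈⟨ +-congˡ (-‿distribʳ-* x _) ⟨
      - fromInt a + - (x * eval g x)    ≈⟨ -‿+-comm _ _ ⟩
      - (fromInt a + x * eval g x)      ∎

    ℤ[θ]-refl : ∀ x → x - x ∈ ℤ[θ]
    ℤ[θ]-refl x = [] , -‿inverseʳ x

    ℤ[θ]-sym : ∀ x y → x - y ∈ ℤ[θ] → y - x ∈ ℤ[θ]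
    ℤ[θ]-sym x y (g , eq) = map ℤ.-_ g , (begin
      y - x                ≈⟨ ⁻¹-anti-homo‿- x y ⟨
      - (x - y)            ≈⟨ -‿cong eq ⟩
      - eval g θ           ≈⟨ eval-neg g θ ⟨
      eval (map ℤ.-_ g) θ  ∎)

    ℤ[θ]-trans : ∀ x y z → x - y ∈ ℤ[θ] → y - z ∈ ℤ[θ] → x - z ∈ ℤ[θ]
    ℤ[θ]-trans x y z (g , eq₁) (h , eq₂) = g +ₚ h , (begin
      x - z                  ≈⟨ +-congʳ (+-identityʳ x) ⟨
      (x + 0#) - z           ≈⟨ +-congʳ (+-congˡ (-‿inverseˡ y)) ⟨
      (x + (- y + y)) - z    ≈⟨ +-congʳ (+-assoc x (- y) y) ⟨
      ((x - y) + y) - z      ≈⟨ +-assoc (x - y) y (- z) ⟩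
      (x - y) + (y - z)      ≈⟨ +-cong eq₁ eq₂ ⟩
      eval g θ + eval h θ    ≈⟨ eval-+ g h θ ⟨
      eval (g +ₚ h) θ        ∎)

  𝒪/ℤ[θ] : Setoid (c ⊔ ℓ₁) ℓ₁
  𝒪/ℤ[θ] = record
    { Carrier       = Σ Carrier 𝒪
    ; _≈_           = λ (x , _) (y , _) → x - y ∈ ℤ[θ]
    ; isEquivalence = record
      { refl  = λ {(x , _)} → ℤ[θ]-refl x
      ; sym   = λ {(x , _)} {(y , _)} → ℤ[θ]-sym x y
      ; trans = λ {(x , _)} {(y , _)} {(z , _)} → ℤ[θ]-trans x y z
      }
    }

  IsIndex : ℕ → Set (c ⊔ ℓ₁)
  IsIndex N = Bijection 𝒪/ℤ[θ] (≡.setoid (Fin N))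

  -- The index is a natural number determined by IsIndex; quantifying over
  -- its value avoids having to compute it.
  _-Maximal : ℕ → Set (c ⊔ ℓ₁)
  p -Maximal = ∀ N → IsIndex N → ¬ (p ∣ N)

{-# OPTIONS --safe #-}

-- Put t = θ − r and M = 𝒪/ℤ[θ], a finite ℤ[θ]-module, and suppose that p divides
-- its order.
--
-- Because p² ∤ f(r), no nonzero element of M is killed by both p and t: after
-- subtracting an element of ℤ[θ], a class y with p y, t y ∈ ℤ[θ] satisfies t y = b
-- with b ∈ ℤ.  If p ∤ b, clearing the monic equation of y with powers of t gives
-- bᵈ y ∈ ℤ[θ]; if p ∣ b, the relation f(r) = − t w with w ∈ ℤ[θ] gives the claim.
--
-- By the pigeonhole principle there is an e ≥ 1 with sᴺ (1 − sᵉ) M = 0 for s = p, t,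
-- so (1 − pᵉ)(1 − tᵉ) M = 0 and (1 − tᵉ) 𝒪 ⊆ ℤ[θ] + p𝒪.  Hence the ideal
-- Q = { x ∈ 𝒪 : x𝒪 ⊆ ℤ[θ] + p𝒪 } contains the conductor, p and 1 − tᵉ.  It is proper,
-- as otherwise multiplication by p would be onto M and the order of M prime to p.
-- A maximal ideal above Q contains t by hypothesis, hence also 1.

module Submission where

open import Defs
open import Algebra.Bundles using (CommutativeRing)
open import Algebra.Definitions.RawSemiring ℤ[X]-rawSemiring using (Irreducible)
open import Algebra.Morphism.Structures using (IsRingHomomorphism)
import Algebra.Solver.Ring as Solver
open import Algebra.Solver.Ring.AlmostCommutativeRing
  using (fromCommutativeRing; _-Raw-AlmostCommutative⟶_)
open import Data.Fin.Base using (Fin; zero; suc; toℕ)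
open import Data.Fin.Permutation using (Permutation′; permutation; _⟨$⟩ʳ_)
import Data.Fin.Properties as Fin
open import Data.Integer.Base as ℤ using (ℤ; +_; 0ℤ; 1ℤ; -1ℤ)
open import Data.Integer.Divisibility using (_∣_)
import Data.Integer.Divisibility.Signed as Signed
import Data.Integer.DivMod as ℤ
import Data.Integer.Properties as ℤ
open import Data.Integer.Solver using () renaming (module +-*-Solver to ℤ-Solver)
open import Data.List.Base using (List; []; _∷_; map; allFin; upTo; cartesianProductWith)
open import Data.List.Membership.Propositional using () renaming (_∈_ to _∈ₗ_)
open import Data.List.Membership.Propositional.Properties
  using (∈-allFin; ∈-cartesianProductWith⁺; ∈-cartesianProductWith⁻; ∈-map⁺; ∈-map⁻; ∈-upTo⁺)
open import Data.List.Relation.Unary.All as All using (All; []; _∷_)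
open import Data.List.Relation.Unary.Any using (here; there)
open import Data.Maybe.Base as Maybe using (Maybe)
open import Data.Nat.Base as ℕ using (ℕ; zero; suc; _≤_; _!)
open import Data.Nat.Coprimality using (Coprime; coprime-Bézout)
import Data.Nat.Divisibility as ℕ
import Data.Nat.GCD as ℕ
open import Data.Nat.Primality
  using (Prime; euclidsLemma; prime⇒irreducible; prime⇒nonZero; ¬prime[1])
import Data.Nat.Properties as ℕ
open import Data.Nat.Solver using () renaming (module +-*-Solver to ℕ-Solver)
open import Data.Product.Base using (∃-syntax; _×_; _,_; proj₁; proj₂)
import Data.Rational.Base as ℚ
open import Data.Rational.Literals using (fromℤ)
import Data.Rational.Properties as ℚ
open import Data.Sum.Base using (inj₁; inj₂; [_,_]′)
open import Function.Bundles using (Bijection)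
open import Level using (_⊔_)
open import Relation.Binary.Bundles using (Setoid)
open import Relation.Binary.PropositionalEquality as ≡ using (_≡_)
import Relation.Binary.Reasoning.Setoid as SetoidReasoning
open import Relation.Nullary.Decidable using (yes; no; dec⇒maybe; ¬¬-excluded-middle)
open import Relation.Nullary.Negation using (¬_; contradiction)
open import Relation.Unary using (Pred; _∈_; _⊆_)

-- Transitive actions by commuting permutations.

-- The number of elements of a finite transitive abelian group action.  Starting
-- from an indicator function, averaging over every permutation yields a constant
-- function whose total is a power of the exponent.
module TransitiveAction where
  open import Data.Nat.Base using (_+_; _*_)
  open ≡ using (refl; sym; trans; cong; cong₂; subst)
  open ≡.≡-Reasoning
  open import Algebra.Properties.CommutativeMonoid.Sum ℕ.+-0-commutativeMonoid
    using (sum; sum-permute; ∑-distrib-+; sum-cong-≗; sum-replicate-zero)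

  module _ {n : ℕ} where

    infixr 8 _^[_]_

    _^[_]_ : Permutation′ n → ℕ → Fin n → Fin n
    π ^[ zero ]  i = i
    π ^[ suc q ] i = π ^[ q ] (π ⟨$⟩ʳ i)

    -- The average of `F` over `q` steps of `π`, left undivided so that its values stay natural
    -- numbers.
    orbitSum : Permutation′ n → ℕ → (Fin n → ℕ) → Fin n → ℕ
    orbitSum π zero    F i = 0
    orbitSum π (suc q) F i = F i + orbitSum π q F (π ⟨$⟩ʳ i)

    orbitSum-last : ∀ π q F i → orbitSum π (suc q) F i ≡ orbitSum π q F i + F (π ^[ q ] i)
    orbitSum-last π zero    F i = ℕ.+-comm (F i) 0
    orbitSum-last π (suc q) F i = begin
      F i + orbitSum π (suc q) F (π ⟨$⟩ʳ i)
        ≡⟨ cong (λ m → F i + m) (orbitSum-last π q F (π ⟨$⟩ʳ i)) ⟩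
      F i + (orbitSum π q F (π ⟨$⟩ʳ i) + F (π ^[ suc q ] i))
        ≡⟨ ℕ.+-assoc (F i) _ _ ⟨
      orbitSum π (suc q) F i + F (π ^[ suc q ] i) ∎

    -- Shifting the sum drops the term at `i` and appends the term at `π ^[ q ] i`, which is the
    -- same point. Adding `F i` to both sides avoids subtraction in ℕ.
    orbitSum-invariant : ∀ π q F → (∀ i → π ^[ q ] i ≡ i) →
                         ∀ i → orbitSum π q F (π ⟨$⟩ʳ i) ≡ orbitSum π q F i
    orbitSum-invariant π q F π^q≡id i = ℕ.+-cancelˡ-≡ (F i) _ _ (begin
      orbitSum π (suc q) F i             ≡⟨ orbitSum-last π q F i ⟩
      orbitSum π q F i + F (π ^[ q ] i)  ≡⟨ cong (λ j → orbitSum π q F i + F j) (π^q≡id i) ⟩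
      orbitSum π q F i + F i             ≡⟨ ℕ.+-comm _ (F i) ⟩
      F i + orbitSum π q F i             ∎)

    -- Averages can be composed: because the permutations commute, averaging over `π` does not
    -- destroy an invariance already obtained under `ρ`.
    orbitSum-preserves : ∀ π ρ q F →
      (∀ i → π ⟨$⟩ʳ (ρ ⟨$⟩ʳ i) ≡ ρ ⟨$⟩ʳ (π ⟨$⟩ʳ i)) →
      (∀ i → F (ρ ⟨$⟩ʳ i) ≡ F i) →
      ∀ i → orbitSum π q F (ρ ⟨$⟩ʳ i) ≡ orbitSum π q F i
    orbitSum-preserves π ρ zero    F comm inv i = refl
    orbitSum-preserves π ρ (suc q) F comm inv i = cong₂ _+_ (inv i)
      (trans (cong (orbitSum π q F) (comm i)) (orbitSum-preserves π ρ q F comm inv _))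

    sum-orbitSum : ∀ π q F → sum (orbitSum π q F) ≡ q * sum F
    sum-orbitSum π zero    F = sum-replicate-zero n
    sum-orbitSum π (suc q) F = begin
      sum (λ i → F i + orbitSum π q F (π ⟨$⟩ʳ i))
        ≡⟨ ∑-distrib-+ F (λ i → orbitSum π q F (π ⟨$⟩ʳ i)) ⟩
      sum F + sum (λ i → orbitSum π q F (π ⟨$⟩ʳ i))
        ≡⟨ cong (λ m → sum F + m) (sum-permute (orbitSum π q F) π) ⟨
      sum F + sum (orbitSum π q F)
        ≡⟨ cong (λ m → sum F + m) (sum-orbitSum π q F) ⟩
      suc q * sum F ∎

  sum-const : ∀ n k → sum {n} (λ _ → k) ≡ n * k
  sum-const zero    k = refl
  sum-const (suc n) k = cong (λ m → k + m) (sum-const n k)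

  prime∤transitive-action :
    ∀ {a n p q} {I : Set a} (π : I → Permutation′ n) → Fin n → Prime p → ¬ p ℕ.∣ q →
    (∀ x y i → π x ⟨$⟩ʳ (π y ⟨$⟩ʳ i) ≡ π y ⟨$⟩ʳ (π x ⟨$⟩ʳ i)) →
    (∀ x i → π x ^[ q ] i ≡ i) →
    (∀ i j → ∃[ x ] π x ⟨$⟩ʳ i ≡ j) →
    ¬ p ℕ.∣ n
  prime∤transitive-action {n = suc n} {p} {q} {I} π _ p-prime p∤q comm π^q≡id transitive p∣n =
    -- One element carrying `zero` to each point is enough, so the list of averages is finite even
    -- when `I` is not.
    let F , p∤F , inv = invariant (map (λ j → proj₁ (transitive zero j)) (allFin _))
        constant : ∀ j → F j ≡ F zero
        constant j = let x , eq = transitive zero j in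
          trans (cong F (sym eq)) (All.lookup inv (∈-map⁺ _ (∈-allFin j)) zero)
    in p∤F (subst (p ℕ.∣_) (sym (trans (sum-cong-≗ constant) (sum-const (suc n) (F zero))))
            (ℕ.∣m⇒∣m*n (F zero) p∣n))
    where
    Invariant : (Fin (suc n) → ℕ) → I → Set
    Invariant F x = ∀ i → F (π x ⟨$⟩ʳ i) ≡ F i

    invariant : ∀ xs → ∃[ F ] ¬ (p ℕ.∣ sum F) × All (Invariant F) xs
    invariant [] = (λ { zero → 1 ; (suc _) → 0 }) , p∤1 , []
      where
      p∤1 : ¬ p ℕ.∣ suc (sum {n} (λ _ → 0))
      p∤1 p∣1 rewrite sum-replicate-zero n =
        contradiction (ℕ.∣1⇒≡1 p∣1) λ { refl → ¬prime[1] p-prime }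
    -- Each averaging multiplies the total by `q`, so starting from the total 1 of the indicator it
    -- never becomes divisible by `p`.
    invariant (x ∷ xs) with F , p∤F , inv ← invariant xs =
        orbitSum (π x) q F
      , (λ p∣ → [ p∤q , p∤F ]′ (euclidsLemma q (sum F) p-prime
                   (subst (p ℕ.∣_) (sum-orbitSum (π x) q F) p∣)))
      , orbitSum-invariant (π x) q F (π^q≡id x)
      ∷ All.map (λ {y} → orbitSum-preserves (π x) (π y) q F (comm x y)) inv

-- The integers in ℚ and in its extension fields.

fromℤ-+ : ∀ a b → fromℤ (a ℤ.+ b) ≡ fromℤ a ℚ.+ fromℤ b
fromℤ-+ a b = ≡.trans (≡.sym (ℚ.↥p/↧p≡p (fromℤ (a ℤ.+ b))))
  (≡.cong (ℚ._/ 1) (≡.sym (≡.cong₂ ℤ._+_ (ℤ.*-identityʳ a) (ℤ.*-identityʳ b))))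

fromℤ-* : ∀ a b → fromℤ (a ℤ.* b) ≡ fromℤ a ℚ.* fromℤ b
fromℤ-* a b = ≡.sym (ℚ.↥p/↧p≡p (fromℤ (a ℤ.* b)))

fromℤ-neg : ∀ a → fromℤ (ℤ.- a) ≡ ℚ.- fromℤ a
fromℤ-neg (+ zero)     = ≡.refl
fromℤ-neg (+ suc _)    = ≡.refl
fromℤ-neg (ℤ.-[1+ _ ]) = ≡.refl

module IntegerCoefficients {c ℓ₁ ℓ₂} (E : ExtensionOfℚ c ℓ₁ ℓ₂) where
  open ExtensionOfℚ E
  private module ι = IsRingHomomorphism ι-isRingHomomorphism

  fromInt-+ : ∀ a b → fromInt (a ℤ.+ b) ≈ fromInt a + fromInt b
  fromInt-+ a b = trans (ι.⟦⟧-cong (fromℤ-+ a b)) (ι.+-homo _ _)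

  fromInt-* : ∀ a b → fromInt (a ℤ.* b) ≈ fromInt a * fromInt b
  fromInt-* a b = trans (ι.⟦⟧-cong (fromℤ-* a b)) (ι.*-homo _ _)

  fromInt-neg : ∀ a → fromInt (ℤ.- a) ≈ - fromInt a
  fromInt-neg a = trans (ι.⟦⟧-cong (fromℤ-neg a)) (ι.-‿homo _)

  fromInt-0 : fromInt 0ℤ ≈ 0#
  fromInt-0 = ι.0#-homo

  fromInt-1 : fromInt 1ℤ ≈ 1#
  fromInt-1 = ι.1#-homo

  fromInt-homomorphism :
    ℤ.+-*-rawRing -Raw-AlmostCommutative⟶ fromCommutativeRing commutativeRing
  fromInt-homomorphism = record
    { ⟦_⟧ = fromInt ; +-homo = fromInt-+ ; *-homo = fromInt-*
    ; -‿homo = fromInt-neg ; 0-homo = fromInt-0 ; 1-homo = fromInt-1 }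

  fromInt-≟ : ∀ a b → Maybe (fromInt a ≈ fromInt b)
  fromInt-≟ a b = Maybe.map (λ { ≡.refl → refl }) (dec⇒maybe (a ℤ.≟ b))

  module RingSolver = Solver ℤ.+-*-rawRing (fromCommutativeRing commutativeRing)
    fromInt-homomorphism fromInt-≟

-- Polynomial expressions in one element, with degree bounds.

module IntegralElements {c ℓ₁ ℓ₂} (E : ExtensionOfℚ c ℓ₁ ℓ₂) where
  open ExtensionOfℚ E hiding (zero)
  open IntegerCoefficients E
  open RingSolver

  -- Poly z a k x: the element x is an integral polynomial expression in z of the
  -- form a₀ + a₁ z + … + aₖ₋₁ zᵏ⁻¹ + a zᵏ.  It is monic of degree k for a = 1
  -- and of degree below k for a = 0.
  data Poly (z : Carrier) (a : ℤ) : ℕ → Pred Carrier (c ⊔ ℓ₁) where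
    const : ∀ {x} → x ≈ fromInt a → Poly z a 0 x
    step  : ∀ {k x} b y → Poly z a k y → x ≈ fromInt b + z * y → Poly z a (suc k) x

  module _ {z : Carrier} where

    Poly-resp : ∀ {a k x y} → x ≈ y → Poly z a k x → Poly z a k y
    Poly-resp x≈y (const eq)      = const (trans (sym x≈y) eq)
    Poly-resp x≈y (step b w h eq) = step b w h (trans (sym x≈y) eq)

    Poly-0 : ∀ k → Poly z 0ℤ k 0#
    Poly-0 zero    = const (sym fromInt-0)
    Poly-0 (suc k) = step 0ℤ 0# (Poly-0 k)
      (sym (trans (+-cong fromInt-0 (zeroʳ z)) (+-identityʳ 0#)))

    Poly-+ : ∀ {a b k x y} → Poly z a k x → Poly z b k y → Poly z (a ℤ.+ b) k (x + y)
    Poly-+ {a} {b} (const eq) (const eq′) =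
      const (trans (+-cong eq eq′) (sym (fromInt-+ a b)))
    Poly-+ (step a x′ h eq) (step b y′ h′ eq′) = step (a ℤ.+ b) (x′ + y′) (Poly-+ h h′)
      (trans (+-cong eq eq′)
        (trans
          (solve 5 (λ a b z x y → (a :+ z :* x) :+ (b :+ z :* y) := (a :+ b) :+ z :* (x :+ y))
            refl (fromInt a) (fromInt b) z x′ y′)
          (+-congʳ (sym (fromInt-+ a b)))))

    Poly-scale : ∀ {a k x} b → Poly z a k x → Poly z (b ℤ.* a) k (fromInt b * x)
    Poly-scale {a} b (const eq) = const (trans (*-congˡ eq) (sym (fromInt-* b a)))
    Poly-scale b (step a x h eq) = step (b ℤ.* a) (fromInt b * x) (Poly-scale b h)
      (trans (*-congˡ eq)
        (trans
          (solve 4 (λ a b z x → b :* (a :+ z :* x) := b :* a :+ z :* (b :* x))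
            refl (fromInt a) (fromInt b) z x)
          (+-congʳ (sym (fromInt-* b a)))))

    Poly-- : ∀ {a b k x y} → Poly z a k x → Poly z b k y →
             Poly z (a ℤ.+ -1ℤ ℤ.* b) k (x - y)
    Poly-- {x = x} {y} h h′ = Poly-resp
      (solve 2 (λ x y → x :+ con -1ℤ :* y := x :- y) refl x y)
      (Poly-+ h (Poly-scale -1ℤ h′))

    Poly-weaken : ∀ {a k x} → Poly z a k x → Poly z 0ℤ (suc k) x
    Poly-weaken {a} (const eq) = step a 0# (Poly-0 0)
      (trans eq (sym (trans (+-congˡ (zeroʳ z)) (+-identityʳ _))))
    Poly-weaken (step b y h eq) = step b y (Poly-weaken h) eq

    Poly-weaken+ : ∀ {a k x} j → Poly z a k x → Poly z 0ℤ (suc (j ℕ.+ k)) x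
    Poly-weaken+ zero    h = Poly-weaken h
    Poly-weaken+ (suc j) h = Poly-weaken (Poly-weaken+ j h)

    -- Only the part divisible by `z` reaches the top degree; the constant term `d` contributes
    -- `d * y`, whose degree bound is raised to match.
    Poly-* : ∀ {a b j k x y} → Poly z a j x → Poly z b k y →
             Poly z (a ℤ.* b) (j ℕ.+ k) (x * y)
    Poly-* {a} (const eq) h = Poly-resp (*-congʳ (sym eq)) (Poly-scale a h)
    Poly-* {a} {b} {suc j} {y = y} (step d x′ h eq) h′ = Poly-resp
      (trans (solve 4 (λ d z x y → d :* y :+ (con 0ℤ :+ z :* (x :* y)) := (d :+ z :* x) :* y)
               refl (fromInt d) z x′ y)
             (*-congʳ (sym eq)))
      (≡.subst (λ e → Poly z e _ _) (ℤ.+-identityˡ (a ℤ.* b))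
        (Poly-+ {0ℤ} (Poly-weaken+ j (Poly-scale d h′)) (step 0ℤ _ (Poly-* h h′) refl)))

    Poly-leading : ∀ {k x} → Poly z 0ℤ (suc k) x → ∃[ a ] Poly z a k x
    Poly-leading {zero} (step b y (const y≈0) eq) = b , const
      (trans eq (trans (+-congˡ (trans (*-congˡ (trans y≈0 fromInt-0)) (zeroʳ z))) (+-identityʳ _)))
    Poly-leading {suc k} (step b y h eq) with a , h′ ← Poly-leading h = a , step b y h′ eq

    -- Division by a monic relation satisfied by z.
    Poly-reduce : ∀ {k x} → Poly z 1ℤ k 0# → Poly z 0ℤ (suc k) x → Poly z 0ℤ k x
    Poly-reduce {k} {x} monic h with a , h′ ← Poly-leading h =
      ≡.subst (λ e → Poly z e k x) (cancel a)
        (Poly-resp (solve 2 (λ b x → x :+ b :* con 0ℤ := x) refl (fromInt (ℤ.- a)) x)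
          (Poly-+ h′ (Poly-resp (*-congˡ (sym fromInt-0)) (Poly-scale (ℤ.- a) monic))))
      where
      cancel : ∀ a → a ℤ.+ ℤ.- a ℤ.* 1ℤ ≡ 0ℤ
      cancel a = ≡.trans (≡.cong (λ b → a ℤ.+ b) (ℤ.*-identityʳ (ℤ.- a))) (ℤ.+-inverseʳ a)

    -- Going through `Poly-reduce` covers k = 0 as well, where the monic relation reads 0 = 1.
    Poly-1 : ∀ {k} → Poly z 1ℤ k 0# → Poly z 0ℤ k 1#
    Poly-1 {k} monic = Poly-reduce monic
      (≡.subst (λ j → Poly z 0ℤ (suc j) 1#) (ℕ.+-identityʳ k)
        (Poly-weaken+ k (const {a = 1ℤ} (sym fromInt-1))))

    Poly-shift : ∀ {k x} → Poly z 1ℤ k 0# → Poly z 0ℤ k x → Poly z 0ℤ k (z * x)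
    Poly-shift monic h = Poly-reduce monic
      (step 0ℤ _ h (sym (trans (+-congʳ fromInt-0) (+-identityˡ _))))

    eval-Poly : ∀ {k} g → MonicOfDegree k g → Poly z 1ℤ k (eval g z)
    eval-Poly {zero} [] (() , _)
    eval-Poly {suc k} [] (() , _)
    eval-Poly {zero} (a ∷ g) (a≡1 , g≡0) = const
      (trans (+-cong (reflexive (≡.cong fromInt a≡1))
                     (trans (*-congˡ (eval-0 g λ i → g≡0 (suc i) (ℕ.s≤s ℕ.z≤n))) (zeroʳ z)))
             (+-identityʳ _))
      where
      eval-0 : ∀ g → (∀ i → coeff g i ≡ 0ℤ) → eval g z ≈ 0#
      eval-0 []      _   = refl
      eval-0 (a ∷ g) g≡0 = trans
        (+-cong (trans (reflexive (≡.cong fromInt (g≡0 0))) fromInt-0)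
                (trans (*-congˡ (eval-0 g λ i → g≡0 (suc i))) (zeroʳ z)))
        (+-identityʳ 0#)
    eval-Poly {suc k} (a ∷ g) (lead , g≡0) =
      step a _ (eval-Poly g (lead , λ i k<i → g≡0 (suc i) (ℕ.s≤s k<i))) refl

    Poly-eval : ∀ {a k x} → Poly z a k x →
      ∃[ g ] coeff g k ≡ a × (∀ i → k ℕ.< i → coeff g i ≡ 0ℤ) × eval g z ≈ x
    Poly-eval {a} (const eq) = a ∷ [] , ≡.refl , (λ { (suc i) _ → ≡.refl })
      , trans (+-congˡ (zeroʳ z)) (trans (+-identityʳ _) (sym eq))
    Poly-eval (step b y h eq) with g , lead , g≡0 , eval≈ ← Poly-eval h =
        b ∷ g , lead , (λ { (suc i) (ℕ.s≤s k<i) → g≡0 i k<i })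
      , trans (+-congˡ (*-congˡ eval≈)) (sym eq)

  -- Linear combinations and elimination.

  data Combination {p} (P : Pred Carrier p) : List Carrier → Pred Carrier (c ⊔ ℓ₁ ⊔ p) where
    []  : ∀ {x} → x ≈ 0# → Combination P [] x
    _∷_ : ∀ {v vs a x y} → P a × x ≈ a * v + y → Combination P vs y → Combination P (v ∷ vs) x

  Combination-resp : ∀ {p} {P : Pred Carrier p} {vs x y} → x ≈ y →
                     Combination P vs x → Combination P vs y
  Combination-resp x≈y ([] eq)        = [] (trans (sym x≈y) eq)
  Combination-resp x≈y ((h , eq) ∷ l) = (h , trans (sym x≈y) eq) ∷ l

  Combination-+ : ∀ {p} {P : Pred Carrier p} → (∀ {x y} → P x → P y → P (x + y)) →
    ∀ {vs x y} → Combination P vs x → Combination P vs y → Combination P vs (x + y)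
  Combination-+ add ([] eq) ([] eq′) = [] (trans (+-cong eq eq′) (+-identityʳ 0#))
  Combination-+ add {v ∷ _} (_∷_ {a = a} {y = x} (h , eq) l) (_∷_ {a = b} {y = y} (h′ , eq′) l′) =
      ( add h h′
      , trans (+-cong eq eq′)
          (solve 5 (λ a b v x y → (a :* v :+ x) :+ (b :* v :+ y) := (a :+ b) :* v :+ (x :+ y))
            refl a b v x y))
    ∷ Combination-+ add l l′

  Combination-scale : ∀ {p q} {P : Pred Carrier p} {Q : Pred Carrier q} {b} →
    (∀ {x} → P x → Q (b * x)) → ∀ {vs x} → Combination P vs x → Combination Q vs (b * x)
  Combination-scale {b = b} mul ([] eq) = [] (trans (*-congˡ eq) (zeroʳ b))
  Combination-scale {b = b} mul {v ∷ _} (_∷_ {a = a} {y = y} (h , eq) l) =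
      (mul h , trans (*-congˡ eq)
        (solve 4 (λ a b v y → b :* (a :* v :+ y) := (b :* a) :* v :+ b :* y) refl a b v y))
    ∷ Combination-scale mul l

  Combination-annihilated : ∀ {p} {P : Pred Carrier p} {d vs x} →
    All (λ v → d * v ≈ 0#) vs → Combination P vs x → d * x ≈ 0#
  Combination-annihilated {d = d} [] ([] eq) = trans (*-congˡ eq) (zeroʳ d)
  Combination-annihilated {d = d} {v ∷ _} (dv≈0 ∷ ann) (_∷_ {a = a} {x} {y} (_ , eq) l) = begin
    d * x                    ≈⟨ *-congˡ eq ⟩
    d * (a * v + y)
      ≈⟨ solve 4 (λ a d v y → d :* (a :* v :+ y) := a :* (d :* v) :+ d :* y) refl a d v y ⟩
    a * (d * v) + d * y      ≈⟨ +-cong (*-congˡ dv≈0) (Combination-annihilated ann l) ⟩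
    a * 0# + 0#              ≈⟨ trans (+-identityʳ _) (zeroʳ a) ⟩
    0#                       ∎
    where open import Relation.Binary.Reasoning.Setoid setoid

  module _ {z : Carrier} where

    -- One row of a linear system for the generators. At the start of the elimination the rows are
    -- those of z·I - A, with A an integer matrix.
    record Relation (vs : List Carrier) (v : Carrier) : Set (c ⊔ ℓ₁) where
      constructor relation
      field
        {degree}   : ℕ
        {diagonal} : Carrier
        monic      : Poly z 1ℤ degree diagonal
        row        : Combination (Poly z 0ℤ degree) vs (diagonal * v)

    Annihilator : List Carrier → Set (c ⊔ ℓ₁)
    Annihilator vs = ∃[ k ] ∃[ d ] Poly z 1ℤ k d × All (λ v → d * v ≈ 0#) vs

    -- Fraction-free Gaussian elimination, a substitute for the characteristic
    -- polynomial: in every row the diagonal stays monic, of degree larger than the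
    -- other entries.
    eliminate : ∀ vs → All (Relation vs) vs → Annihilator vs
    eliminate [] [] = 0 , 1# , const (sym fromInt-1) , []
    eliminate (w ∷ ws) (relation {j} {d} monic (_∷_ {a = a} {y = y} (ha , eq) row) ∷ rows) =
      let m , e , monicₑ , ann = eliminate ws (All.map reduce rows)
          kills : ∀ {v} → e * v ≈ 0# → (e * pivot) * v ≈ 0#
          kills {v} ev≈0 = trans
            (solve 3 (λ e p v → (e :* p) :* v := p :* (e :* v)) refl e pivot v)
            (trans (*-congˡ ev≈0) (zeroʳ pivot))
      -- Since `e` kills the remaining generators it kills `y`, which is `pivot * w`; hence
      -- `e * pivot` kills `w` as well.
      in m ℕ.+ j , e * pivot , Poly-* monicₑ monicₚ
       , trans (trans (*-assoc e pivot w) (*-congˡ pivot-row)) (Combination-annihilated ann row)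
       ∷ All.map kills ann
      where
      -- Moving the term `a * w` to the left keeps the entry monic, as `a` has degree below that of
      -- `d`.
      pivot : Carrier
      pivot = d - a

      monicₚ : Poly z 1ℤ j pivot
      monicₚ = Poly-- monic ha

      pivot-row : pivot * w ≈ y
      pivot-row = trans (solve 3 (λ d a w → (d :- a) :* w := d :* w :- a :* w) refl d a w)
        (trans (+-congʳ eq) (solve 3 (λ a w y → (a :* w :+ y) :- a :* w := y) refl a w y))

      -- The row of `v` is multiplied by `pivot`, and `pivot * w` is replaced by `y`. The new
      -- diagonal `e * pivot` is monic of degree k + j, and all new coefficients stay below that
      -- degree.
      reduce : ∀ {v} → Relation (w ∷ ws) v → Relation ws v
      reduce {v} (relation {k} {e} monic′ (_∷_ {a = b} {y = y′} (hb , eq′) row′)) =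
        relation (Poly-* monic′ monicₚ)
          (Combination-resp
            (trans (+-congʳ (*-congˡ (sym pivot-row)))
              (trans (solve 4 (λ b p w y → b :* (p :* w) :+ p :* y := p :* (b :* w :+ y))
                       refl b pivot w y′)
                (trans (*-congˡ (sym eq′))
                  (solve 3 (λ e p v → p :* (e :* v) := (e :* p) :* v) refl e pivot v))))
            (Combination-+ Poly-+
              (Combination-scale (Poly-* hb) row)
              (Combination-scale (λ {x} h → Poly-resp (*-comm x pivot) (Poly-* h monicₚ)) row′)))

  -- Finitely generated subgroups and closure of integrality under ring operations.

  data Span (vs : List Carrier) : Pred Carrier (c ⊔ ℓ₁) where
    gen  : ∀ {x} → x ∈ₗ vs → Span vs x
    none : Span vs 0#
    add  : ∀ {x y} → Span vs x → Span vs y → Span vs (x + y)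
    neg  : ∀ {x} → Span vs x → Span vs (- x)
    resp : ∀ {x y} → x ≈ y → Span vs x → Span vs y

  Span-linear : ∀ {vs ws} (h : Carrier → Carrier) → (∀ {x y} → x ≈ y → h x ≈ h y) →
    h 0# ≈ 0# → (∀ x y → h (x + y) ≈ h x + h y) → (∀ x → h (- x) ≈ - h x) →
    (∀ {x} → x ∈ₗ vs → Span ws (h x)) → ∀ {x} → Span vs x → Span ws (h x)
  Span-linear h h-cong h-0 h-+ h-neg h-gen = go
    where
    go : ∀ {x} → Span _ x → Span _ (h x)
    go (gen x∈)     = h-gen x∈
    go none         = resp (sym h-0) none
    go (add s t)    = resp (sym (h-+ _ _)) (add (go s) (go t))
    go (neg s)      = resp (sym (h-neg _)) (neg (go s))
    go (resp eq s)  = resp (h-cong eq) (go s)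

  Span-*ˡ : ∀ {vs ws} a → (∀ {x} → x ∈ₗ vs → Span ws (a * x)) →
            ∀ {x} → Span vs x → Span ws (a * x)
  Span-*ˡ a = Span-linear (a *_) *-congˡ (zeroʳ a) (distribˡ a)
    λ x → solve 2 (λ a x → a :* (:- x) := :- (a :* x)) refl a x

  Span-scale : ∀ {vs x} b → Span vs x → Span vs (fromInt b * x)
  Span-scale {vs} {x} b s = go b
    where
    goℕ : ∀ n → Span vs (fromInt (+ n) * x)
    goℕ zero    = resp (sym (trans (*-congʳ fromInt-0) (zeroˡ x))) none
    goℕ (suc n) = resp
      (trans (solve 2 (λ n x → x :+ n :* x := (con 1ℤ :+ n) :* x) refl (fromInt (+ n)) x)
             (*-congʳ (sym (fromInt-+ 1ℤ (+ n)))))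
      (add s (goℕ n))
    go : ∀ b → Span vs (fromInt b * x)
    go (+ n)      = goℕ n
    go ℤ.-[1+ n ] = resp
      (trans (solve 2 (λ n x → :- (n :* x) := (:- n) :* x) refl (fromInt (+ suc n)) x)
             (*-congʳ (sym (fromInt-neg (+ suc n)))))
      (neg (goℕ (suc n)))

  -- Integer coefficients are the polynomials of degree below 1, so a relation with diagonal `z` has
  -- the degree gap that elimination requires.
  Span⇒Combination : ∀ {z vs x} → Span vs x → Combination (Poly z 0ℤ 1) vs x
  Span⇒Combination {z} = go
    where
    zeros : ∀ vs → Combination (Poly z 0ℤ 1) vs 0#
    zeros []       = [] refl
    zeros (v ∷ vs) = (Poly-0 1 , sym (trans (+-identityʳ _) (zeroˡ v))) ∷ zeros vs

    gens : ∀ {vs x} → x ∈ₗ vs → Combination (Poly z 0ℤ 1) vs x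
    gens {v ∷ vs} (here ≡.refl) =
        (Poly-weaken (const {a = 1ℤ} (sym fromInt-1)) , sym (trans (+-identityʳ _) (*-identityˡ v)))
      ∷ zeros vs
    gens {v ∷ vs} (there x∈) =
      (Poly-0 1 , sym (trans (+-congʳ (zeroˡ v)) (+-identityˡ _))) ∷ gens x∈

    go : ∀ {vs x} → Span vs x → Combination (Poly z 0ℤ 1) vs x
    go (gen x∈)    = gens x∈
    go none        = zeros _
    go (add s t)   = Combination-+ Poly-+ (go s) (go t)
    go (neg {x} s) = Combination-resp
      (solve 1 (λ x → con -1ℤ :* x := :- x) refl x)
      (Combination-scale (Poly-scale -1ℤ) (go s))
    go (resp eq s) = Combination-resp eq (go s)

  -- The usual module criterion for integrality: a finitely generated additive group that contains 1
  -- and is mapped to itself by `z`.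
  record Stable (z : Carrier) (vs : List Carrier) : Set (c ⊔ ℓ₁) where
    constructor stable
    field
      unit  : Span vs 1#
      shift : ∀ {v} → v ∈ₗ vs → Span vs (z * v)

    shift* : ∀ {x} → Span vs x → Span vs (z * x)
    shift* = Span-*ˡ z shift

  IsIntegral′ : Pred Carrier (c ⊔ ℓ₁)
  IsIntegral′ z = ∃[ k ] Poly z 1ℤ k 0#

  -- Elimination on the rows `z * v` gives a monic expression in `z` that kills every generator,
  -- hence kills 1, hence vanishes.
  stable⇒integral : ∀ {z vs} → Stable z vs → IsIntegral′ z
  stable⇒integral {z} {vs} (stable unit shift) =
    let k , d , monic , ann = eliminate vs (All.tabulate λ v∈ →
          relation monic-z (Span⇒Combination (shift v∈)))
    in k , Poly-resp (trans (sym (*-identityʳ d))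
                       (Combination-annihilated ann (Span⇒Combination {z} unit))) monic
    where
    monic-z : Poly z 1ℤ 1 z
    monic-z = step 0ℤ 1# (const (sym fromInt-1))
      (sym (trans (+-cong fromInt-0 (*-identityʳ z)) (+-identityˡ z)))

  integral⇒stable : ∀ {z} → IsIntegral′ z → ∃[ vs ] Stable z vs
  integral⇒stable {z} (k , monic) = powers k , stable (span (Poly-1 monic))
    λ v∈ → span (Poly-shift monic (powers-Poly k v∈))
    where
    powers : ℕ → List Carrier
    powers zero    = []
    powers (suc k) = 1# ∷ map (z *_) (powers k)

    powers-Poly : ∀ k {v} → v ∈ₗ powers k → Poly z 0ℤ k v
    powers-Poly (suc k) (here ≡.refl) = step 1ℤ 0# (Poly-0 k)
      (sym (trans (+-cong fromInt-1 (zeroʳ z)) (+-identityʳ 1#)))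
    powers-Poly (suc k) (there v∈) with w , w∈ , ≡.refl ← ∈-map⁻ (z *_) v∈ =
      step 0ℤ w (powers-Poly k w∈) (sym (trans (+-congʳ fromInt-0) (+-identityˡ _)))

    span : ∀ {k x} → Poly z 0ℤ k x → Span (powers k) x
    span (const eq) = resp (sym (trans eq fromInt-0)) none
    span (step b y h eq) = resp
      (trans (+-congʳ (*-identityʳ _)) (sym eq))
      (add (Span-scale b (gen (here ≡.refl)))
           (Span-*ˡ z (λ v∈ → gen (there (∈-map⁺ (z *_) v∈))) (span h)))

  -- The products of generators of the two groups span one group stable under both `x` and `y`,
  -- hence under their sum and product.
  module _ {x y : Carrier} (hx : IsIntegral′ x) (hy : IsIntegral′ y) where
    private
      us vs ws : List Carrier
      us = proj₁ (integral⇒stable hx)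
      vs = proj₁ (integral⇒stable hy)
      ws = cartesianProductWith _*_ us vs

      module X = Stable (proj₂ (integral⇒stable hx))
      module Y = Stable (proj₂ (integral⇒stable hy))

      Span-⊗ : ∀ {a b} → Span us a → Span vs b → Span ws (a * b)
      Span-⊗ {a} {b} s t = resp (*-comm b a) (Span-*ˡ b
        (λ {u} u∈ → resp (*-comm u b) (Span-*ˡ u (λ v∈ → gen (∈-cartesianProductWith⁺ _*_ u∈ v∈)) t)) s)

      unit : Span ws 1#
      unit = resp (*-identityʳ 1#) (Span-⊗ X.unit Y.unit)

      stable-x : Stable x ws
      stable-x = stable unit λ w∈ →
        let u , v , u∈ , v∈ , eq = ∈-cartesianProductWith⁻ _*_ us vs w∈
        in resp (trans (*-assoc x u v) (*-congˡ (reflexive (≡.sym eq)))) (Span-⊗ (X.shift u∈) (gen v∈))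

      stable-y : Stable y ws
      stable-y = stable unit λ w∈ →
        let u , v , u∈ , v∈ , eq = ∈-cartesianProductWith⁻ _*_ us vs w∈
        in resp (trans (solve 3 (λ u v y → u :* (y :* v) := y :* (u :* v)) refl u v y)
                       (*-congˡ (reflexive (≡.sym eq)))) (Span-⊗ (gen u∈) (Y.shift v∈))

    integral-+ : IsIntegral′ (x + y)
    integral-+ = stable⇒integral (stable unit λ {v} v∈ →
      resp (sym (distribʳ v x y)) (add (Stable.shift stable-x v∈) (Stable.shift stable-y v∈)))

    integral-* : IsIntegral′ (x * y)
    integral-* = stable⇒integral (stable unit λ {v} v∈ →
      resp (sym (*-assoc x y v)) (Stable.shift* stable-x (Stable.shift stable-y v∈)))

  integral-neg : ∀ {x} → IsIntegral′ x → IsIntegral′ (- x)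
  integral-neg {x} hx with vs , stable unit shift ← integral⇒stable hx =
    stable⇒integral (stable unit λ {v} v∈ →
      resp (solve 2 (λ x v → :- (x :* v) := (:- x) :* v) refl x v) (neg (shift v∈)))

  integral-fromInt : ∀ a → IsIntegral′ (fromInt a)
  integral-fromInt a = 1 , step (ℤ.- a) 1# (const (sym fromInt-1))
    (sym (trans (+-cong (fromInt-neg a) (*-identityʳ _)) (-‿inverseˡ _)))

-- Coprime integers.

prime∧∤⇒coprime : ∀ {p n} → Prime p → ¬ p ℕ.∣ n → Coprime p n
prime∧∤⇒coprime p-prime p∤n (d∣p , d∣n) with prime⇒irreducible p-prime d∣p
... | inj₁ d≡1    = d≡1
... | inj₂ ≡.refl = contradiction d∣n p∤n

bezout : ∀ m b → Coprime m ℤ.∣ b ∣ → ∃[ u ] ∃[ v ] u ℤ.* (+ m) ℤ.+ v ℤ.* b ≡ 1ℤ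
bezout m b coprime = let s , sb≡∣b∣ = signed in go s sb≡∣b∣ (coprime-Bézout coprime)
  where
  open ≡.≡-Reasoning
  open ℤ-Solver

  -- The factor `s` is a sign that turns `b` into its absolute value; it is absorbed into the
  -- coefficient of `b`.
  signed : ∃[ s ] s ℤ.* b ≡ + ℤ.∣ b ∣
  signed with ℤ.+∣i∣≡i⊎+∣i∣≡-i b
  ... | inj₁ eq = 1ℤ , ≡.trans (ℤ.*-identityˡ b) (≡.sym eq)
  ... | inj₂ eq = -1ℤ , ≡.trans (ℤ.-1*i≡-i b) (≡.sym eq)

  pos : ∀ {x y j k} → 1 ℕ.+ y ℕ.* k ≡ x ℕ.* j →
        1ℤ ℤ.+ + y ℤ.* + k ≡ + x ℤ.* + j
  pos {x} {y} {j} {k} eq = ≡.trans (≡.cong (λ i → 1ℤ ℤ.+ i) (≡.sym (ℤ.pos-* y k)))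
    (≡.trans (≡.cong +_ eq) (ℤ.pos-* x j))

  go : ∀ s → s ℤ.* b ≡ + ℤ.∣ b ∣ → ℕ.Bézout.Identity 1 m ℤ.∣ b ∣ →
       ∃[ u ] ∃[ v ] u ℤ.* (+ m) ℤ.+ v ℤ.* b ≡ 1ℤ
  go s sb≡∣b∣ (ℕ.Bézout.+- x y eq) = + x , ℤ.- (+ y) ℤ.* s , (begin
    + x ℤ.* + m ℤ.+ ℤ.- (+ y) ℤ.* s ℤ.* b
      ≡⟨ ≡.cong (λ i → i ℤ.+ ℤ.- (+ y) ℤ.* s ℤ.* b) (pos {x} {y} eq) ⟨
    1ℤ ℤ.+ + y ℤ.* + ℤ.∣ b ∣ ℤ.+ ℤ.- (+ y) ℤ.* s ℤ.* b
      ≡⟨ ≡.cong (λ i → 1ℤ ℤ.+ + y ℤ.* i ℤ.+ ℤ.- (+ y) ℤ.* s ℤ.* b) sb≡∣b∣ ⟨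
    1ℤ ℤ.+ + y ℤ.* (s ℤ.* b) ℤ.+ ℤ.- (+ y) ℤ.* s ℤ.* b
      ≡⟨ solve 3 (λ y s b → con 1ℤ :+ y :* (s :* b) :+ (:- y) :* s :* b := con 1ℤ)
           ≡.refl (+ y) s b ⟩
    1ℤ ∎)
  go s sb≡∣b∣ (ℕ.Bézout.-+ x y eq) = ℤ.- (+ x) , + y ℤ.* s , (begin
    ℤ.- (+ x) ℤ.* + m ℤ.+ + y ℤ.* s ℤ.* b
      ≡⟨ ≡.cong (λ i → ℤ.- (+ x) ℤ.* + m ℤ.+ i) (ℤ.*-assoc (+ y) s b) ⟩
    ℤ.- (+ x) ℤ.* + m ℤ.+ + y ℤ.* (s ℤ.* b)
      ≡⟨ ≡.cong (λ i → ℤ.- (+ x) ℤ.* + m ℤ.+ + y ℤ.* i) sb≡∣b∣ ⟩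
    ℤ.- (+ x) ℤ.* + m ℤ.+ + y ℤ.* + ℤ.∣ b ∣
      ≡⟨ ≡.cong (λ i → ℤ.- (+ x) ℤ.* + m ℤ.+ i) (pos {y} {x} eq) ⟨
    ℤ.- (+ x) ℤ.* + m ℤ.+ (1ℤ ℤ.+ + x ℤ.* + m)
      ≡⟨ solve 2 (λ x m → (:- x) :* m :+ (con 1ℤ :+ x :* m) := con 1ℤ) ≡.refl (+ x) (+ m) ⟩
    1ℤ ∎)

open TransitiveAction using (_^[_]_; prime∤transitive-action)
open IntegralElements

-- The ring ℤ[θ] inside the ring of integers.

module Order {c ℓ₁ ℓ₂} (E : ExtensionOfℚ c ℓ₁ ℓ₂) (θ : ExtensionOfℚ.Carrier E)
             (n : ℕ) (θ-integral : Poly E θ 1ℤ n (ExtensionOfℚ.0# E)) where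
  open ExtensionOfℚ E hiding (zero)
  open NumberField E θ
  open IntegerCoefficients E
  open RingSolver
  open import Algebra.Properties.Semiring.Exp (CommutativeRing.semiring commutativeRing)
    using (_^_; ^-homo-*; ^-congʳ)
  open import Relation.Binary.Reasoning.Setoid setoid

  A : Pred Carrier ℓ₁
  A = ℤ[θ]

  abstract
    Poly⇒A : ∀ {k x} → Poly E θ 0ℤ k x → A x
    Poly⇒A h = let g , _ , _ , eval≈ = Poly-eval E h in g , sym eval≈

    -- Horner's scheme, reduced modulo the monic relation of θ after each step. The uniform bound
    -- `n` later leaves only finitely many residues modulo p.
    A⇒Poly : ∀ {x} → A x → Poly E θ 0ℤ n x
    A⇒Poly (g , eq) = Poly-resp E (sym eq) (eval-Poly′ g)
      where
      eval-Poly′ : ∀ g → Poly E θ 0ℤ n (eval g θ)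
      eval-Poly′ []      = Poly-0 E n
      eval-Poly′ (a ∷ g) = Poly-reduce E θ-integral (step a _ (eval-Poly′ g) refl)

    A-resp : ∀ {x y} → x ≈ y → A x → A y
    A-resp x≈y (g , eq) = g , trans (sym x≈y) eq

    A-0 : A 0#
    A-0 = [] , refl

    A-fromInt : ∀ a → A (fromInt a)
    A-fromInt a = a ∷ [] , sym (trans (+-congˡ (zeroʳ θ)) (+-identityʳ _))

    A-1 : A 1#
    A-1 = A-resp fromInt-1 (A-fromInt 1ℤ)

    A-θ : A θ
    A-θ = Poly⇒A {2} (step 0ℤ 1# (Poly-weaken E (const {a = 1ℤ} (sym fromInt-1)))
      (sym (trans (+-cong fromInt-0 (*-identityʳ θ)) (+-identityˡ θ))))

    A-+ : ∀ {x y} → A x → A y → A (x + y)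
    A-+ hx hy = Poly⇒A (Poly-+ E (A⇒Poly hx) (A⇒Poly hy))

    A-- : ∀ {x y} → A x → A y → A (x - y)
    A-- hx hy = Poly⇒A (Poly-- E (A⇒Poly hx) (A⇒Poly hy))

    A-neg : ∀ {x} → A x → A (- x)
    A-neg hx = A-resp (+-identityˡ _) (A-- A-0 hx)

    A-* : ∀ {x y} → A x → A y → A (x * y)
    A-* hx hy = Poly⇒A (Poly-* E (A⇒Poly hx) (A⇒Poly hy))

    A-^ : ∀ {x} → A x → ∀ k → A (x ^ k)
    A-^ hx zero    = A-1
    A-^ hx (suc k) = A-* hx (A-^ hx k)

    IsIntegral⇒Poly : ∀ {x} → IsIntegral x → IsIntegral′ E x
    IsIntegral⇒Poly (d , g , monic , eval≈0) = d , Poly-resp E eval≈0 (eval-Poly E g monic)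

    Poly⇒IsIntegral : ∀ {x} → IsIntegral′ E x → IsIntegral x
    Poly⇒IsIntegral (k , h) = let g , lead , g≡0 , eval≈0 = Poly-eval E h in
      k , g , (lead , g≡0) , eval≈0

    𝒪-resp : ∀ {x y} → x ≈ y → 𝒪 x → 𝒪 y
    𝒪-resp x≈y (x∈K , x-int) = respects x≈y x∈K , (let k , h = IsIntegral⇒Poly x-int in
      Poly⇒IsIntegral (stable⇒integral E (let vs , stable u s = integral⇒stable E (k , h) in
        stable {vs = vs} u λ v∈ → resp (*-congʳ x≈y) (s v∈))))

    𝒪-+ : ∀ {x y} → 𝒪 x → 𝒪 y → 𝒪 (x + y)
    𝒪-+ (x∈K , hx) (y∈K , hy) = sum x∈K y∈K
      , Poly⇒IsIntegral (integral-+ E (IsIntegral⇒Poly hx) (IsIntegral⇒Poly hy))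

    𝒪-* : ∀ {x y} → 𝒪 x → 𝒪 y → 𝒪 (x * y)
    𝒪-* (x∈K , hx) (y∈K , hy) = product x∈K y∈K
      , Poly⇒IsIntegral (integral-* E (IsIntegral⇒Poly hx) (IsIntegral⇒Poly hy))

    𝒪-neg : ∀ {x} → 𝒪 x → 𝒪 (- x)
    𝒪-neg (x∈K , hx) = negative x∈K , Poly⇒IsIntegral (integral-neg E (IsIntegral⇒Poly hx))

    𝒪-- : ∀ {x y} → 𝒪 x → 𝒪 y → 𝒪 (x - y)
    𝒪-- hx hy = 𝒪-+ hx (𝒪-neg hy)

    𝒪-fromInt : ∀ a → 𝒪 (fromInt a)
    𝒪-fromInt a = rational _ , Poly⇒IsIntegral (integral-fromInt E a)

    A⊆𝒪 : A ⊆ 𝒪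
    A⊆𝒪 (g , eq) = 𝒪-resp (sym eq) (eval∈𝒪 g)
      where
      eval∈𝒪 : ∀ g → 𝒪 (eval g θ)
      eval∈𝒪 []      = 𝒪-resp fromInt-0 (𝒪-fromInt 0ℤ)
      eval∈𝒪 (a ∷ g) = 𝒪-+ (𝒪-fromInt a)
        (𝒪-* (generator , Poly⇒IsIntegral (n , θ-integral)) (eval∈𝒪 g))

    𝒪-1 : 𝒪 1#
    𝒪-1 = A⊆𝒪 A-1

  -- Synthetic division of `g` by X - r: the remainder is the value at `r`, and `w` is the value of
  -- the quotient at θ.
  taylor : ∀ g r → ∃[ w ] A w × eval g θ ≈ fromInt (evalℤ g r) + (θ - fromInt r) * w
  taylor [] r = 0# , A-0 , sym (trans (+-cong fromInt-0 (zeroʳ _)) (+-identityʳ 0#))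
  taylor (a ∷ g) r with w , w∈A , eq ← taylor g r =
    e + θ * w , A-+ (A-fromInt (evalℤ g r)) (A-* A-θ w∈A) , (begin
      fromInt a + θ * eval g θ                        ≈⟨ +-congˡ (*-congˡ eq) ⟩
      fromInt a + θ * (e + (θ - fromInt r) * w)
        ≈⟨ solve 5 (λ a θ e r w → a :+ θ :* (e :+ (θ :- r) :* w)
                               := (a :+ r :* e) :+ (θ :- r) :* (e :+ θ :* w))
             refl (fromInt a) θ e (fromInt r) w ⟩
      (fromInt a + fromInt r * e) + (θ - fromInt r) * (e + θ * w)
        ≈⟨ +-congʳ (+-congˡ (fromInt-* r (evalℤ g r))) ⟨
      (fromInt a + fromInt (r ℤ.* evalℤ g r)) + (θ - fromInt r) * (e + θ * w)
        ≈⟨ +-congʳ (fromInt-+ a _) ⟨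
      fromInt (a ℤ.+ r ℤ.* evalℤ g r) + (θ - fromInt r) * (e + θ * w) ∎)
    where
    e = fromInt (evalℤ g r)

  -- If t y = b, then multiplying a monic relation of degree d + 1 for y by tᵈ
  -- clears all the lower powers of y.
  monic-relation : ∀ {t y b d m} → A t → A b → t * y ≈ b → Poly E y 1ℤ (suc d) m →
                   A (t ^ d * m - b ^ d * y)
  monic-relation {t} {y} {b} {zero} {m} t∈A b∈A ty≈b (step a x (const x≈1) eq) =
    A-resp (sym (begin
      1# * m - 1# * y          ≈⟨ +-cong (*-identityˡ m) (-‿cong (*-identityˡ y)) ⟩
      m - y                    ≈⟨ +-congʳ (trans eq (+-congˡ (*-congˡ x≈1))) ⟩
      (fromInt a + y * fromInt 1ℤ) - y
        ≈⟨ solve 2 (λ a y → (a :+ y :* con 1ℤ) :- y := a) refl (fromInt a) y ⟩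
      fromInt a                ∎)) (A-fromInt a)
  monic-relation {t} {y} {b} {suc d} {m} t∈A b∈A ty≈b (step a x h eq) =
    A-resp (sym (begin
      t ^ suc d * m - b ^ suc d * y
        ≈⟨ +-congʳ (*-congˡ eq) ⟩
      (t * t ^ d) * (fromInt a + y * x) - (b * b ^ d) * y
        ≈⟨ solve 7 (λ t t′ a y x b b′ → (t :* t′) :* (a :+ y :* x) :- (b :* b′) :* y
              := ((t :* t′) :* a :+ (t :* y) :* (t′ :* x)) :- b :* (b′ :* y))
             refl t (t ^ d) (fromInt a) y x b (b ^ d) ⟩
      ((t * t ^ d) * fromInt a + (t * y) * (t ^ d * x)) - b * (b ^ d * y)
        ≈⟨ +-congʳ (+-congˡ (*-congʳ ty≈b)) ⟩
      ((t * t ^ d) * fromInt a + b * (t ^ d * x)) - b * (b ^ d * y)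
        ≈⟨ solve 4 (λ u b x y → (u :+ b :* x) :- b :* y := u :+ b :* (x :- y))
             refl ((t * t ^ d) * fromInt a) b (t ^ d * x) (b ^ d * y) ⟩
      t ^ suc d * fromInt a + b * (t ^ d * x - b ^ d * y) ∎))
    (A-+ (A-* (A-^ t∈A (suc d)) (A-fromInt a)) (A-* b∈A (monic-relation t∈A b∈A ty≈b h)))

  -- Torsion of 𝒪/ℤ[θ] under p and t = θ - r.

  module AtPrime (p : ℕ) (p-prime : Prime p) where
    P : Carrier
    P = fromInt (+ p)

    A-P : A P
    A-P = A-fromInt (+ p)

    P-cancel : ∀ {x y} → P * x ≈ P * y → x ≈ y
    P-cancel {x} {y} eq = trans (sym (P⁻¹P x)) (trans (*-congˡ eq) (P⁻¹P y))
      where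
      module ι = IsRingHomomorphism ι-isRingHomomorphism
      instance
        fromℤ-nonZero : ℚ.NonZero (fromℤ (+ p))
        fromℤ-nonZero = prime⇒nonZero p-prime
      P⁻¹P : ∀ x → ι (ℚ.1/ fromℤ (+ p)) * (P * x) ≈ x
      P⁻¹P x = trans (sym (*-assoc _ P x)) (trans
        (*-congʳ (trans (sym (ι.*-homo _ _))
          (trans (ι.⟦⟧-cong (ℚ.*-inverseˡ (fromℤ (+ p)))) ι.1#-homo)))
        (*-identityˡ x))

    A-coprime : ∀ {b x} → ¬ (+ p ∣ b) → A (P * x) → A (fromInt b * x) → A x
    A-coprime {b} {x} p∤b Px∈A bx∈A =
      let u , v , eq = bezout p b (prime∧∤⇒coprime p-prime p∤b) in
      A-resp (begin
        fromInt u * (P * x) + fromInt v * (fromInt b * x)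
          ≈⟨ solve 5 (λ u p v b x → u :* (p :* x) :+ v :* (b :* x) := (u :* p :+ v :* b) :* x)
               refl (fromInt u) P (fromInt v) (fromInt b) x ⟩
        (fromInt u * P + fromInt v * fromInt b) * x
          ≈⟨ *-congʳ (trans (fromInt-+ _ _) (+-cong (fromInt-* u (+ p)) (fromInt-* v b))) ⟨
        fromInt (u ℤ.* (+ p) ℤ.+ v ℤ.* b) * x
          ≈⟨ *-congʳ (trans (reflexive (≡.cong fromInt eq)) fromInt-1) ⟩
        1# * x ≈⟨ *-identityˡ x ⟩
        x ∎)
        (A-+ (A-* (A-fromInt u) Px∈A) (A-* (A-fromInt v) bx∈A))

    -- Each `fromInt b ^ k * x` is again killed by p modulo ℤ[θ], so the factors `b` can be removed
    -- one at a time.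
    A-coprime-^ : ∀ {b x} → ¬ (+ p ∣ b) → A (P * x) → ∀ k → A (fromInt b ^ k * x) → A x
    A-coprime-^ p∤b Px∈A zero    h = A-resp (*-identityˡ _) h
    A-coprime-^ {b} {x} p∤b Px∈A (suc k) h = A-coprime-^ p∤b Px∈A k
      (A-coprime p∤b
        (A-resp (solve 3 (λ p b x → b :* (p :* x) := p :* (b :* x)) refl P (fromInt b ^ k) x)
          (A-* (A-^ (A-fromInt b) k) Px∈A))
        (A-resp (*-assoc (fromInt b) (fromInt b ^ k) x) h))

    module AtRoot (f : ℤ[X]) (fθ≈0 : eval f θ ≈ 0#) (r : ℤ)
                  (p²∤fr : ¬ (+ (p ℕ.^ 2) ∣ evalℤ f r)) where
      t : Carrier
      t = θ - fromInt r

      A-t : A t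
      A-t = A-- A-θ (A-fromInt r)

      -- Multiply 0 = f(θ) = f(r) + t w by `y` and use t y = b.
      f[r]y≈-wb : ∀ {y b} w → eval f θ ≈ fromInt (evalℤ f r) + t * w → t * y ≈ b →
                  fromInt (evalℤ f r) * y ≈ - (w * b)
      f[r]y≈-wb {y} {b} w eq ty≈b = begin
        fromInt (evalℤ f r) * y
          ≈⟨ solve 4 (λ e t w y → e :* y := (e :+ t :* w) :* y :- w :* (t :* y))
               refl (fromInt (evalℤ f r)) t w y ⟩
        (fromInt (evalℤ f r) + t * w) * y - w * (t * y)
          ≈⟨ +-cong (*-congʳ (trans (sym eq) fθ≈0)) (-‿cong (*-congˡ ty≈b)) ⟩
        0# * y - w * b
          ≈⟨ trans (+-congʳ (zeroˡ y)) (+-identityˡ _) ⟩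
        - (w * b) ∎

      normalised : ∀ {y b} → 𝒪 y → A (P * y) → t * y ≈ fromInt b → A y
      normalised {y} {b} (_ , y-int) Py∈A ty≈b with p ℕ.∣? ℤ.∣ b ∣
      ... | no p∤b = unit (IsIntegral⇒Poly y-int)
        where
        unit : IsIntegral′ E y → A y
        -- A monic relation of degree 0 reads 0 = 1, which makes every element zero.
        unit (zero , const 0≈1) = A-resp (sym (begin
          y       ≈⟨ *-identityʳ y ⟨
          y * 1#  ≈⟨ *-congˡ (trans 0≈1 fromInt-1) ⟨
          y * 0#  ≈⟨ zeroʳ y ⟩
          0#      ∎)) A-0
        -- In `monic-relation` the value m is 0 here, so what lies in ℤ[θ] is bᵈ y up to sign.
        unit (suc d , monic) = A-coprime-^ p∤b Py∈A d
          (A-resp (solve 2 (λ u v → u :* con 0ℤ :- (u :* con 0ℤ :- v) := v)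
                     refl (t ^ d) (fromInt b ^ d * y))
            (A-- (A-* (A-^ A-t d) (A-fromInt 0ℤ))
              (A-resp (+-congʳ (*-congˡ (sym fromInt-0)))
                (monic-relation A-t (A-fromInt b) ty≈b monic))))
      ... | yes p∣b with taylor f r
      ...   | w , w∈A , eq with p ℕ.∣? ℤ.∣ evalℤ f r ∣
      ...     | no p∤fr = A-coprime p∤fr Py∈A
                  (A-resp (sym (f[r]y≈-wb w eq ty≈b)) (A-neg (A-* w∈A (A-fromInt b))))
      ...     | yes p∣fr with Signed.∣ᵤ⇒∣ {+ p} {evalℤ f r} p∣fr | Signed.∣ᵤ⇒∣ {+ p} {b} p∣b
      -- With f(r) = u p and b = v p, cancelling p leaves u y = - w v; the integer u is prime to p
      -- because p² does not divide f(r).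
      ...       | Signed.divides u fr≡up | Signed.divides v b≡vp =
        A-coprime p∤u Py∈A (A-resp (sym uy≈-wv) (A-neg (A-* w∈A (A-fromInt v))))
        where
        p∤u : ¬ (+ p ∣ u)
        p∤u p∣u with Signed.∣ᵤ⇒∣ {+ p} {u} p∣u
        ... | Signed.divides q u≡qp =
          p²∤fr (Signed.∣⇒∣ᵤ {+ (p ℕ.^ 2)} {evalℤ f r} (Signed.divides q
            (≡.trans fr≡up
            (≡.trans (≡.cong (λ i → i ℤ.* + p) u≡qp)
            (≡.trans (ℤ.*-assoc q (+ p) (+ p))
            (≡.trans (≡.cong (λ i → q ℤ.* i) (≡.sym (ℤ.pos-* p p)))
                     (≡.cong (λ k → q ℤ.* + (p ℕ.* k)) (≡.sym (ℕ.*-identityʳ p)))))))))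

        uy≈-wv : fromInt u * y ≈ - (w * fromInt v)
        uy≈-wv = P-cancel (begin
          P * (fromInt u * y)
            ≈⟨ solve 3 (λ p u y → p :* (u :* y) := (u :* p) :* y) refl P (fromInt u) y ⟩
          (fromInt u * P) * y
            ≈⟨ *-congʳ (trans (reflexive (≡.cong fromInt fr≡up)) (fromInt-* u (+ p))) ⟨
          fromInt (evalℤ f r) * y
            ≈⟨ f[r]y≈-wb w eq ty≈b ⟩
          - (w * fromInt b)
            ≈⟨ -‿cong (*-congˡ (trans (reflexive (≡.cong fromInt b≡vp)) (fromInt-* v (+ p)))) ⟩
          - (w * (fromInt v * P))
            ≈⟨ solve 3 (λ w v p → :- (w :* (v :* p)) := p :* (:- (w :* v))) refl w (fromInt v) P ⟩
          P * (- (w * fromInt v)) ∎)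

      -- If t y = g(θ) = g(r) + t w, the representative y - w of the same class satisfies t (y - w)
      -- = g(r), an integer; this is the case treated in `normalised`.
      p,t-torsion-free : ∀ {y} → 𝒪 y → A (P * y) → A (t * y) → A y
      p,t-torsion-free {y} y∈𝒪 Py∈A (g , ty≈g) with w , w∈A , eq ← taylor g r =
        A-resp (solve 2 (λ y w → (y :- w) :+ w := y) refl y w)
          (A-+ (normalised (𝒪-- y∈𝒪 (A⊆𝒪 w∈A))
            (A-resp (solve 3 (λ p y w → p :* y :- p :* w := p :* (y :- w)) refl P y w)
              (A-- Py∈A (A-* A-P w∈A)))
            (begin
              t * (y - w)      ≈⟨ solve 3 (λ t y w → t :* (y :- w) := t :* y :- t :* w) refl t y w ⟩
              t * y - t * w    ≈⟨ +-congʳ (trans ty≈g eq) ⟩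
              (fromInt (evalℤ g r) + t * w) - t * w
                ≈⟨ solve 2 (λ b u → (b :+ u) :- u := b) refl (fromInt (evalℤ g r)) (t * w) ⟩
              fromInt (evalℤ g r) ∎)) w∈A)

      t-power-torsion-free : ∀ k {y} → 𝒪 y → A (P * y) → A (t ^ k * y) → A y
      t-power-torsion-free zero    y∈𝒪 Py∈A h = A-resp (*-identityˡ _) h
      t-power-torsion-free (suc k) {y} y∈𝒪 Py∈A h = p,t-torsion-free y∈𝒪 Py∈A
        (t-power-torsion-free k (𝒪-* (A⊆𝒪 A-t) y∈𝒪)
          (A-resp (solve 3 (λ t p y → t :* (p :* y) := p :* (t :* y)) refl t P y) (A-* A-t Py∈A))
          (A-resp (solve 3 (λ t u y → (t :* u) :* y := u :* (t :* y)) refl t (t ^ k) y) h))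

      -- The element p y is killed by a smaller power of p and by the same power of t; once it lies
      -- in ℤ[θ], the case of exponent one for p applies to y.
      power-torsion-free : ∀ j k {y} → 𝒪 y → A (P ^ j * y) → A (t ^ k * y) → A y
      power-torsion-free zero    k y∈𝒪 h h′ = A-resp (*-identityˡ _) h
      power-torsion-free (suc j) k {y} y∈𝒪 h h′ = t-power-torsion-free k y∈𝒪
        (power-torsion-free j k (𝒪-* (A⊆𝒪 A-P) y∈𝒪)
          (A-resp (solve 3 (λ p u y → (p :* u) :* y := u :* (p :* y)) refl P (P ^ j) y) h)
          (A-resp (solve 3 (λ p u y → p :* (u :* y) := u :* (p :* y)) refl P (t ^ k) y) (A-* A-P h′)))
        h′

-- The finite quotient 𝒪/ℤ[θ] and periodicity of multiplication on it.

common-period : ∀ {i j N} → i ℕ.< j → j ℕ.≤ N →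
  ∃[ d ] ∃[ m ] ∃[ k ] d ℕ.+ i ≡ j × k ℕ.+ i ≡ N × N ! ≡ m ℕ.* d
common-period {i} {N = N} i<j j≤N
  -- The difference j - i is `suc d`, positive and at most N, so it divides N!, with quotient `m`;
  -- `k` is the distance from i to N.
  with d , ≡.refl ← ℕ.m≤n⇒∃[o]m+o≡n i<j
  with k , ≡.refl ← ℕ.m≤n⇒∃[o]m+o≡n (ℕ.≤-trans (ℕ.<⇒≤ i<j) j≤N)
  with ℕ.divides m eq ← ℕ.∣-trans (ℕ.m∣m*n {suc d} (d !))
         (ℕ.m≤n⇒m!∣n! (ℕ.≤-trans (ℕ.s≤s (ℕ.m≤n+m d i)) j≤N))
  = suc d , m , k , ≡.cong suc (ℕ.+-comm d i) , ℕ.+-comm k i , eq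

module Index {c ℓ₁ ℓ₂} (E : ExtensionOfℚ c ℓ₁ ℓ₂) (θ : ExtensionOfℚ.Carrier E)
             (n : ℕ) (θ-integral : Poly E θ 1ℤ n (ExtensionOfℚ.0# E)) where
  open ExtensionOfℚ E hiding (zero)
  open NumberField E θ
  open IntegerCoefficients E
  open RingSolver
  open Order E θ n θ-integral
  open import Algebra.Properties.Semiring.Exp (CommutativeRing.semiring commutativeRing)
    using (_^_; ^-homo-*; ^-congʳ)

  infix 4 _~_

  _~_ : Carrier → Carrier → Set ℓ₁
  x ~ y = A (x - y)

  ~-reflexive : ∀ {x y} → x ≈ y → x ~ y
  ~-reflexive {x} {y} x≈y = A-resp (sym (trans (+-congʳ x≈y) (-‿inverseʳ y))) A-0

  ~-sym : ∀ {x y} → x ~ y → y ~ x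
  ~-sym {x} {y} h = A-resp (solve 2 (λ x y → :- (x :- y) := y :- x) refl x y) (A-neg h)

  ~-trans : ∀ {x y z} → x ~ y → y ~ z → x ~ z
  ~-trans {x} {y} {z} h h′ =
    A-resp (solve 3 (λ x y z → (x :- y) :+ (y :- z) := x :- z) refl x y z) (A-+ h h′)

  ~-+ : ∀ {x y u v} → x ~ y → u ~ v → x + u ~ y + v
  ~-+ {x} {y} {u} {v} h h′ =
    A-resp (solve 4 (λ x y u v → (x :- y) :+ (u :- v) := (x :+ u) :- (y :+ v)) refl x y u v)
      (A-+ h h′)

  ~-* : ∀ {s x y} → A s → x ~ y → s * x ~ s * y
  ~-* {s} {x} {y} s∈A h =
    A-resp (solve 3 (λ s x y → s :* (x :- y) := s :* x :- s :* y) refl s x y) (A-* s∈A h)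

  ~-setoid : Setoid c ℓ₁
  ~-setoid = record { _≈_ = _~_ ; isEquivalence = record
    { refl = ~-reflexive refl ; sym = ~-sym ; trans = ~-trans } }

  open SetoidReasoning ~-setoid

  A∋⇒~0 : ∀ {x} → A x → x ~ 0#
  A∋⇒~0 {x} h = A-- h A-0

  module FiniteIndex (N : ℕ) (index : IsIndex N) where
    module index = Bijection index

    class : ∀ {x} → 𝒪 x → Fin N
    class {x} x∈𝒪 = index.to (x , x∈𝒪)

    rep : Fin N → Carrier
    rep i = proj₁ (index.to⁻ i)

    rep∈𝒪 : ∀ i → 𝒪 (rep i)
    rep∈𝒪 i = proj₂ (index.to⁻ i)

    class-rep : ∀ i → class (rep∈𝒪 i) ≡ i
    class-rep i = proj₂ (index.strictlySurjective i)

    class-injective : ∀ {x y} (hx : 𝒪 x) (hy : 𝒪 y) → class hx ≡ class hy → x ~ y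
    class-injective hx hy = index.injective

    class-cong : ∀ {x y} (hx : 𝒪 x) (hy : 𝒪 y) → x ~ y → class hx ≡ class hy
    class-cong hx hy = index.cong

    rep-class : ∀ {x} (hx : 𝒪 x) → rep (class hx) ~ x
    rep-class hx = class-injective (rep∈𝒪 _) hx (class-rep _)

    -- N ! is a common multiple of the periods that the pigeonhole principle
    -- provides for the individual classes.
    period : ℕ
    period = ℕ.pred (N !)

    -- Among the N + 1 elements s⁰ x, ..., sᴺ x two share a class, at exponents i < j ≤ N. From i on
    -- the sequence has period j - i, hence also period N!, and position N is past i.
    periodic : ∀ {s x} → A s → 𝒪 x → s ^ (suc period ℕ.+ N) * x ~ s ^ N * x
    periodic {s} {x} s∈A x∈𝒪 =
      let i , j , i<j , eq = Fin.pigeonhole (ℕ.n<1+n N) λ i → class (orbit∈𝒪 (toℕ i))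
      in repeat i<j (Fin.toℕ≤pred[n] j) (class-injective (orbit∈𝒪 (toℕ i)) (orbit∈𝒪 (toℕ j)) eq)
      where
      orbit∈𝒪 : ∀ k → 𝒪 (s ^ k * x)
      orbit∈𝒪 k = 𝒪-* (A⊆𝒪 (A-^ s∈A k)) x∈𝒪

      shift : ∀ j k → s ^ (j ℕ.+ k) * x ≈ s ^ j * (s ^ k * x)
      shift j k = trans (*-congʳ (^-homo-* s j k)) (*-assoc _ _ x)

      iterate : ∀ d a m → s ^ (d ℕ.+ a) * x ~ s ^ a * x → s ^ (m ℕ.* d ℕ.+ a) * x ~ s ^ a * x
      iterate d a zero    h = ~-reflexive refl
      iterate d a (suc m) h = begin
        s ^ (d ℕ.+ m ℕ.* d ℕ.+ a) * x
          ≈⟨ ~-reflexive (*-congʳ (^-congʳ s (ℕ.+-assoc d (m ℕ.* d) a))) ⟩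
        s ^ (d ℕ.+ (m ℕ.* d ℕ.+ a)) * x   ≈⟨ ~-reflexive (shift d _) ⟩
        s ^ d * (s ^ (m ℕ.* d ℕ.+ a) * x) ≈⟨ ~-* (A-^ s∈A d) (iterate d a m h) ⟩
        s ^ d * (s ^ a * x)               ≈⟨ ~-reflexive (shift d a) ⟨
        s ^ (d ℕ.+ a) * x                 ≈⟨ h ⟩
        s ^ a * x                         ∎

      repeat : ∀ {i j} → i ℕ.< j → j ℕ.≤ N → s ^ i * x ~ s ^ j * x →
               s ^ (suc period ℕ.+ N) * x ~ s ^ N * x
      repeat {i} {j} i<j j≤N h =
        let d , m , k , d+i≡j , k+i≡N , N!≡md = common-period i<j j≤N in begin
        s ^ (suc period ℕ.+ N) * x
          ≈⟨ ~-reflexive (*-congʳ (^-congʳ s (exponent (m ℕ.* d) k i k+i≡N N!≡md))) ⟩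
        s ^ (k ℕ.+ (m ℕ.* d ℕ.+ i)) * x
          ≈⟨ ~-reflexive (shift k _) ⟩
        s ^ k * (s ^ (m ℕ.* d ℕ.+ i) * x)
          ≈⟨ ~-* (A-^ s∈A k) (iterate d i m
               (~-trans (~-reflexive (*-congʳ (^-congʳ s d+i≡j))) (~-sym h))) ⟩
        s ^ k * (s ^ i * x)
          ≈⟨ ~-reflexive (shift k i) ⟨
        s ^ (k ℕ.+ i) * x
          ≈⟨ ~-reflexive (*-congʳ (^-congʳ s k+i≡N)) ⟩
        s ^ N * x ∎
        where
        exponent : ∀ u k i → k ℕ.+ i ≡ N → N ! ≡ u → suc period ℕ.+ N ≡ k ℕ.+ (u ℕ.+ i)
        exponent u k i k+i≡N N!≡u = ≡.trans
          (≡.cong₂ ℕ._+_ (≡.trans (ℕ.suc-pred (N !) {{N ℕ.!≢0}}) N!≡u) (≡.sym k+i≡N))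
          (ℕ-Solver.solve 3 (λ u i k → u :+ⁿ (k :+ⁿ i) :=ⁿ k :+ⁿ (u :+ⁿ i)) ≡.refl u i k)
          where open ℕ-Solver using () renaming (_:+_ to infixl 7 _:+ⁿ_; _:=_ to infix 4 _:=ⁿ_)

    -- The index is prime to p when multiplication by p is onto.

    module _ (p : ℕ) (p-prime : Prime p) where
      open AtPrime p p-prime

      A+P𝒪 : Pred Carrier (c ⊔ ℓ₁)
      A+P𝒪 x = ∃[ y ] 𝒪 y × x ~ P * y

      P-power : ∀ k → P ^ k ≈ fromInt (+ (p ℕ.^ k))
      P-power zero    = sym fromInt-1
      P-power (suc k) = trans (*-congˡ (P-power k))
        (sym (trans (reflexive (≡.cong fromInt (ℤ.pos-* p (p ℕ.^ k)))) (fromInt-* _ _)))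

      module Divisible (divisible : 𝒪 ⊆ A+P𝒪) where
        divisible-^ : ∀ k {x} → 𝒪 x → ∃[ y ] 𝒪 y × x ~ P ^ k * y
        divisible-^ zero {x} x∈𝒪 = x , x∈𝒪 , ~-reflexive (sym (*-identityˡ x))
        divisible-^ (suc k) {x} x∈𝒪 with y , y∈𝒪 , x~ ← divisible-^ k x∈𝒪
          with z , z∈𝒪 , y~ ← divisible y∈𝒪 = z , z∈𝒪 , (begin
            x               ≈⟨ x~ ⟩
            P ^ k * y       ≈⟨ ~-* (A-^ A-P k) y~ ⟩
            P ^ k * (P * z)
              ≈⟨ ~-reflexive
                   (solve 3 (λ u p z → u :* (p :* z) := (p :* u) :* z) refl (P ^ k) P z) ⟩
            P ^ suc k * z   ∎)

        exponent : ℕ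
        exponent = ℕ.pred (p ℕ.^ suc period)

        suc-exponent : suc exponent ≡ p ℕ.^ suc period
        suc-exponent = ℕ.suc-pred (p ℕ.^ suc period)
          {{ℕ.m^n≢0 p (suc period) {{prime⇒nonZero p-prime}}}}

        p∤exponent : ¬ p ℕ.∣ exponent
        p∤exponent p∣q = contradiction
          (ℕ.∣1⇒≡1 (ℕ.∣m+n∣m⇒∣n
            (≡.subst (p ℕ.∣_) (≡.trans (≡.sym suc-exponent) (ℕ.+-comm 1 exponent))
              (ℕ.m∣m*n (p ℕ.^ period))) p∣q))
          λ { ≡.refl → ¬prime[1] p-prime }

        -- Every class is pᴺ times another, and on such classes multiplication by p^(N!) is the
        -- identity by `periodic`.
        exponent-kills : ∀ {x} → 𝒪 x → fromInt (+ exponent) * x ~ 0#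
        exponent-kills {x} x∈𝒪 with y , y∈𝒪 , x~ ← divisible-^ N x∈𝒪 = begin
          fromInt (+ exponent) * x
            ≈⟨ ~-reflexive (solve 2 (λ q x → q :* x := (con 1ℤ :+ q) :* x :- x)
                 refl (fromInt (+ exponent)) x) ⟩
          (fromInt 1ℤ + fromInt (+ exponent)) * x - x
            ≈⟨ ~-reflexive (+-congʳ (*-congʳ (trans (sym (fromInt-+ 1ℤ (+ exponent)))
                 (trans (reflexive (≡.cong (λ k → fromInt (+ k)) suc-exponent))
                        (sym (P-power (suc period))))))) ⟩
          P ^ suc period * x - x
            ≈⟨ A∋⇒~0 fixed ⟩
          0# ∎
          where
          fixed : P ^ suc period * x ~ x
          fixed = begin
            P ^ suc period * x              ≈⟨ ~-* (A-^ A-P (suc period)) x~ ⟩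
            P ^ suc period * (P ^ N * y)
              ≈⟨ ~-reflexive (trans (*-congʳ (^-homo-* P (suc period) N)) (*-assoc _ _ y)) ⟨
            P ^ (suc period ℕ.+ N) * y      ≈⟨ periodic A-P y∈𝒪 ⟩
            P ^ N * y                       ≈⟨ x~ ⟨
            x                               ∎

        translation : ∃[ x ] 𝒪 x → Permutation′ N
        translation (x , x∈𝒪) = permutation
          (λ i → class (𝒪-+ (rep∈𝒪 i) x∈𝒪))
          (λ i → class (𝒪-- (rep∈𝒪 i) x∈𝒪))
          (λ i → class≡ (~-trans (~-+ (rep-class (𝒪-- (rep∈𝒪 i) x∈𝒪)) (~-reflexive refl))
            (~-reflexive (solve 2 (λ r x → (r :- x) :+ x := r) refl (rep i) x))))
          (λ i → class≡ (~-trans (~-+ (rep-class (𝒪-+ (rep∈𝒪 i) x∈𝒪)) (~-reflexive refl))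
            (~-reflexive (solve 2 (λ r x → (r :+ x) :- x := r) refl (rep i) x))))
          where
          class≡ : ∀ {y i} {y∈𝒪 : 𝒪 y} → y ~ rep i → class y∈𝒪 ≡ i
          class≡ {i = i} {y∈𝒪} h = ≡.trans (class-cong y∈𝒪 (rep∈𝒪 i) h) (class-rep i)

        rep-translation : ∀ (x : ∃[ x ] 𝒪 x) i → rep (translation x ⟨$⟩ʳ i) ~ rep i + proj₁ x
        rep-translation (x , x∈𝒪) i = rep-class _

        rep-injective : ∀ {i j} → rep i ~ rep j → i ≡ j
        rep-injective {i} {j} h = ≡.trans (≡.sym (class-rep i))
          (≡.trans (class-cong (rep∈𝒪 i) (rep∈𝒪 j) h) (class-rep j))

        rep-translation-^ : ∀ (x : ∃[ x ] 𝒪 x) k i →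
          rep (translation x ^[ k ] i) ~ rep i + fromInt (+ k) * proj₁ x
        rep-translation-^ (x , _) zero i = ~-reflexive
          (sym (trans (+-congˡ (trans (*-congʳ fromInt-0) (zeroˡ x))) (+-identityʳ _)))
        rep-translation-^ x@(x₀ , _) (suc k) i = begin
          rep (translation x ^[ k ] (translation x ⟨$⟩ʳ i))
            ≈⟨ rep-translation-^ x k _ ⟩
          rep (translation x ⟨$⟩ʳ i) + fromInt (+ k) * x₀
            ≈⟨ ~-+ (rep-translation x i) (~-reflexive refl) ⟩
          (rep i + x₀) + fromInt (+ k) * x₀
            ≈⟨ ~-reflexive (trans
                 (solve 3 (λ r x k → (r :+ x) :+ k :* x := r :+ (con 1ℤ :+ k) :* x)
                   refl (rep i) x₀ (fromInt (+ k)))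
                 (+-congˡ (*-congʳ (sym (fromInt-+ 1ℤ (+ k)))))) ⟩
          rep i + fromInt (+ suc k) * x₀ ∎

        -- The quotient acts on its own N classes by translation, transitively, and it has an
        -- exponent prime to p.
        p∤index : ¬ p ℕ.∣ N
        p∤index = prime∤transitive-action translation (class 𝒪-1) p-prime p∤exponent
          (λ x y i → rep-injective (begin
            rep (translation x ⟨$⟩ʳ (translation y ⟨$⟩ʳ i))
              ≈⟨ ~-trans (rep-translation x _) (~-+ (rep-translation y i) (~-reflexive refl)) ⟩
            (rep i + proj₁ y) + proj₁ x
              ≈⟨ ~-reflexive (solve 3 (λ r x y → (r :+ y) :+ x := (r :+ x) :+ y)
                   refl (rep i) (proj₁ x) (proj₁ y)) ⟩
            (rep i + proj₁ x) + proj₁ y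
              ≈⟨ ~-trans (rep-translation y _) (~-+ (rep-translation x i) (~-reflexive refl)) ⟨
            rep (translation y ⟨$⟩ʳ (translation x ⟨$⟩ʳ i)) ∎))
          (λ x i → rep-injective (begin
            rep (translation x ^[ exponent ] i)
              ≈⟨ rep-translation-^ x exponent i ⟩
            rep i + fromInt (+ exponent) * proj₁ x
              ≈⟨ ~-+ (~-reflexive refl) (exponent-kills (proj₂ x)) ⟩
            rep i + 0#  ≈⟨ ~-reflexive (+-identityʳ _) ⟩
            rep i       ∎))
          (λ i j → (rep j - rep i , 𝒪-- (rep∈𝒪 j) (rep∈𝒪 i)) ,
            rep-injective (~-trans (rep-translation _ i)
              (~-reflexive (solve 2 (λ r s → r :+ (s :- r) := s) refl (rep i) (rep j)))))

      -- The ideal Q and maximal ideals above it.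

      Q : Pred Carrier (c ⊔ ℓ₁)
      Q x = 𝒪 x × (∀ {y} → 𝒪 y → A+P𝒪 (x * y))

      Q-isIdeal : IsIdeal Q
      Q-isIdeal = record
        { ⊆𝒪 = proj₁
        ; resp = λ { x≈y (x∈𝒪 , h) → 𝒪-resp x≈y x∈𝒪 , λ y∈𝒪 → let z , z∈𝒪 , eq = h y∈𝒪 in
            z , z∈𝒪 , ~-trans (~-reflexive (*-congʳ (sym x≈y))) eq }
        ; 0∈ = A⊆𝒪 A-0 , λ {y} y∈𝒪 → 0# , A⊆𝒪 A-0 ,
            ~-reflexive (trans (zeroˡ y) (sym (zeroʳ P)))
        ; +-closed = λ { {x} {y} (x∈𝒪 , h) (y∈𝒪 , h′) → 𝒪-+ x∈𝒪 y∈𝒪 , λ {z} z∈𝒪 →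
            let u , u∈𝒪 , eq = h z∈𝒪 ; v , v∈𝒪 , eq′ = h′ z∈𝒪 in
            u + v , 𝒪-+ u∈𝒪 v∈𝒪 ,
            ~-trans (~-reflexive (distribʳ z x y))
              (~-trans (~-+ eq eq′) (~-reflexive (sym (distribˡ P u v)))) }
        ; *-closed = λ { {a} {x} a∈𝒪 (x∈𝒪 , h) → 𝒪-* a∈𝒪 x∈𝒪 , λ {z} z∈𝒪 →
            let u , u∈𝒪 , eq = h (𝒪-* a∈𝒪 z∈𝒪) in u , u∈𝒪 ,
            ~-trans (~-reflexive (solve 3 (λ a x z → (a :* x) :* z := x :* (a :* z)) refl a x z)) eq }
        }

      -- Consequently membership in an ideal containing `Q` depends only on the class modulo p𝒪.
      P𝒪⊆Q : ∀ {z} → 𝒪 z → Q (P * z)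
      P𝒪⊆Q {z} z∈𝒪 = 𝒪-* (A⊆𝒪 A-P) z∈𝒪 , λ {y} y∈𝒪 →
        z * y , 𝒪-* z∈𝒪 y∈𝒪 , ~-reflexive (*-assoc P z y)

      Conductor⊆Q : Conductor ⊆ Q
      Conductor⊆Q (x∈𝒪 , h) = x∈𝒪 , λ {y} y∈𝒪 → 0# , A⊆𝒪 A-0 ,
        ~-trans (A∋⇒~0 (h y y∈𝒪)) (~-reflexive (sym (zeroʳ P)))

      Q-proper : p ℕ.∣ N → ¬ (𝒪 ⊆ Q)
      Q-proper p∣N 𝒪⊆Q = Divisible.p∤index (λ {x} x∈𝒪 →
        let z , z∈𝒪 , eq = proj₂ (𝒪⊆Q 𝒪-1) x∈𝒪 in
        z , z∈𝒪 , ~-trans (~-reflexive (sym (*-identityˡ x))) eq) p∣N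

      -- Values at θ of the polynomials of degree below the given bound with coefficients from 0 to
      -- p - 1; for the bound `n` they represent ℤ[θ] modulo p.
      residues : ℕ → List Carrier
      residues zero    = 0# ∷ []
      residues (suc k) =
        cartesianProductWith (λ i l → fromInt (+ i) + θ * l) (upTo p) (residues k)

      reduce : ∀ {k x} → Poly E θ 0ℤ k x → ∃[ l ] l ∈ₗ residues k × ∃[ z ] A z × x - l ≈ P * z
      reduce {x = x} (const eq) = 0# , here ≡.refl , 0# , A-0 ,
        trans (+-congʳ (trans eq fromInt-0)) (trans (-‿inverseʳ 0#) (sym (zeroʳ P)))
      reduce {suc k} {x} (step b y h eq) =
        let l , l∈ , z , z∈A , y-l≈Pz = reduce h
            i = b ℤ.%ℕ p
            j = b ℤ./ℕ p
        in fromInt (+ i) + θ * l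
         , ∈-cartesianProductWith⁺ _ (∈-upTo⁺ (ℤ.n%ℕd<d b p)) l∈
         , fromInt j + θ * z , A-+ (A-fromInt j) (A-* A-θ z∈A)
         , trans (+-congʳ (trans eq (+-congʳ
             (trans (reflexive (≡.cong fromInt (ℤ.a≡a%ℕn+[a/ℕn]*n b p)))
               (trans (fromInt-+ _ _) (+-congˡ (fromInt-* j (+ p))))))))
           (trans (solve 6 (λ i j p θ y l → ((i :+ j :* p) :+ θ :* y) :- (i :+ θ :* l)
                             := j :* p :+ θ :* (y :- l)) refl (fromInt (+ i)) (fromInt j) P θ y l)
             (trans (+-congˡ (*-congˡ y-l≈Pz))
               (solve 4 (λ j p θ z → j :* p :+ θ :* (p :* z) := p :* (j :+ θ :* z))
                 refl (fromInt j) P θ z)))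
        where instance _ = prime⇒nonZero p-prime

      -- A finite list that meets every class of 𝒪/p𝒪.
      representatives : List Carrier
      representatives = cartesianProductWith _+_ (map rep (allFin N)) (residues n)

      represent : ∀ {x} → 𝒪 x → ∃[ l ] l ∈ₗ representatives × ∃[ z ] 𝒪 z × x - l ≈ P * z
      represent {x} x∈𝒪 =
        let i = class x∈𝒪
            l , l∈ , z , z∈A , eq = reduce (A⇒Poly (~-sym (rep-class x∈𝒪)))
        in rep i + l
         , ∈-cartesianProductWith⁺ _+_ (∈-map⁺ rep (∈-allFin i)) l∈
         , z , A⊆𝒪 z∈A
         , trans (solve 3 (λ x r l → x :- (r :+ l) := (x :- r) :- l) refl x (rep i) l) eq

      Proper : Pred Carrier (c ⊔ ℓ₁) → Set (c ⊔ ℓ₁)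
      Proper J = IsIdeal J × ¬ (𝒪 ⊆ J)

      -- Enlarging J to contain l whenever some proper ideal allows it decides the
      -- membership of l in all larger proper ideals.
      saturate : ∀ ls J → Proper J →
        ¬ ¬ (∃[ M ] Proper M × J ⊆ M ×
             All (λ l → ∀ J′ → Proper J′ → M ⊆ J′ → l ∈ J′ → l ∈ M) ls)
      saturate []       J J-proper k = k (J , J-proper , (λ {_} x∈ → x∈) , [])
      saturate (l ∷ ls) J J-proper k =
        -- Excluded middle is used once for each entry of the list, under a double negation; this
        -- suffices because the final claim p ∤ N is a negation.
        ¬¬-excluded-middle {A = ∃[ J′ ] Proper J′ × J ⊆ J′ × l ∈ J′} λ where
          (yes (J′ , J′-proper , J⊆J′ , l∈J′)) → saturate ls J′ J′-proper
            λ (M , M-proper , J′⊆M , sat) →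
              k (M , M-proper , (λ {_} x∈ → J′⊆M (J⊆J′ x∈)) , (λ _ _ _ _ → J′⊆M l∈J′) ∷ sat)
          (no ∄J′) → saturate ls J J-proper
            λ (M , M-proper , J⊆M , sat) →
              k (M , M-proper , J⊆M , (λ J′ J′-proper M⊆J′ l∈J′ →
                contradiction (J′ , J′-proper , (λ {_} x∈ → M⊆J′ (J⊆M x∈)) , l∈J′) ∄J′) ∷ sat)

      -- Ideals above `Q` are determined by which representatives they contain, so a proper ideal
      -- saturated for this finite list is maximal.
      maximal-ideal : ¬ (𝒪 ⊆ Q) → ¬ ¬ (∃[ M ] IsMaximalIdeal M × Q ⊆ M)
      maximal-ideal Q≢𝒪 k = saturate representatives Q (Q-isIdeal , Q≢𝒪)
        λ (M , (M-isIdeal , M≢𝒪) , Q⊆M , sat) → k (M , record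
          { isIdeal = M-isIdeal
          ; proper  = M≢𝒪
          ; maximal = λ J J-isIdeal M⊆J J≢𝒪 {x} x∈J →
              let module J = IsIdeal J-isIdeal
                  module M = IsIdeal M-isIdeal
                  -- Write x = l + p z with l in the list. Since p z lies in both ideals, x ∈ J
                  -- gives l ∈ J, saturation gives l ∈ M, and x ∈ M follows.
                  l , l∈ , z , z∈𝒪 , x-l≈Pz = represent (J.⊆𝒪 x∈J)
                  l∈J = J.resp (trans (+-congˡ (*-congˡ (sym x-l≈Pz)))
                                 (solve 2 (λ x l → x :+ con -1ℤ :* (x :- l) := l) refl x l))
                          (J.+-closed x∈J (J.*-closed (𝒪-fromInt -1ℤ) (M⊆J (Q⊆M (P𝒪⊆Q z∈𝒪)))))
                  l∈M = All.lookup sat l∈ J (J-isIdeal , J≢𝒪) M⊆J l∈J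
              in M.resp (trans (+-congˡ (sym x-l≈Pz))
                           (solve 2 (λ x l → l :+ (x :- l) := x) refl x l))
                   (M.+-closed l∈M (Q⊆M (P𝒪⊆Q z∈𝒪)))
          } , Q⊆M)

      -- The contradiction at a maximal ideal above Q.

      module _ (f : ℤ[X]) (fθ≈0 : eval f θ ≈ 0#) (r : ℤ)
               (p²∤fr : ¬ (+ (p ℕ.^ 2) ∣ evalℤ f r)) where
        open AtRoot f fθ≈0 r p²∤fr

        -- On a finite module, 1 - sᵉ annihilates the part where s is bijective and leaves only
        -- s-power torsion; with e = `suc period` this is `periodic` rearranged.
        periodic-part : ∀ {s x} → A s → 𝒪 x → A (s ^ N * (x - s ^ suc period * x))
        periodic-part {s} {x} s∈A x∈𝒪 = A-resp
          (trans (-‿cong (+-congʳ (*-congʳ (^-homo-* s (suc period) N))))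
            (solve 3 (λ u v x → :- ((u :* v) :* x :- v :* x) := v :* (x :- u :* x))
              refl (s ^ suc period) (s ^ N) x))
          (A-neg (periodic s∈A x∈𝒪))

        1-t^e∈Q : Q (1# - t ^ suc period)
        1-t^e∈Q = 𝒪-- 𝒪-1 (A⊆𝒪 (A-^ A-t (suc period))) , λ {y} y∈𝒪 →
          let u = t ^ suc period
              -- In the quotient, w = (1 - tᵉ) y is t-power torsion, and v = (1 - pᵉ) w is moreover
              -- p-power torsion, so v ∈ ℤ[θ].
              w = y - u * y
              w∈𝒪 = 𝒪-- y∈𝒪 (𝒪-* (A⊆𝒪 (A-^ A-t (suc period))) y∈𝒪)
              v = w - P ^ suc period * w
              v∈𝒪 = 𝒪-- w∈𝒪 (𝒪-* (A⊆𝒪 (A-^ A-P (suc period))) w∈𝒪)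
              v∈A = power-torsion-free N N v∈𝒪 (periodic-part A-P w∈𝒪)
                (A-resp (solve 3 (λ u q w → (u :* w) :- q :* (u :* w) := u :* (w :- q :* w))
                           refl (t ^ N) (P ^ suc period) w)
                  (A-- (periodic-part A-t y∈𝒪)
                       (A-* (A-^ A-P (suc period)) (periodic-part A-t y∈𝒪))))
          -- Since e ≥ 1, one factor p can be split off pᵉ: w = v + p (p^(e-1) w).
          in P ^ period * w , 𝒪-* (A⊆𝒪 (A-^ A-P period)) w∈𝒪 ,
             A-resp (trans
               (solve 3 (λ w p q → w :- (p :* q) :* w := w :- p :* (q :* w))
                 refl w P (P ^ period))
               (+-congʳ (trans (+-congʳ (sym (*-identityˡ y)))
                 (solve 3 (λ i u y → i :* y :- u :* y := (i :- u) :* y) refl 1# u y)))) v∈A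

        p-maximal :
          (∀ M → IsMaximalIdeal M → Conductor ⊆ M → P ∈ M → t ∈ M) → ¬ p ℕ.∣ N
        p-maximal t∈all p∣N = maximal-ideal (Q-proper p∣N) λ (M , M-maximal , Q⊆M) →
          let module Max = IsMaximalIdeal M-maximal
              module M = IsIdeal Max.isIdeal
              t∈M = t∈all M M-maximal (λ {_} x∈ → Q⊆M (Conductor⊆Q x∈))
                      (M.resp (*-identityʳ P) (Q⊆M (P𝒪⊆Q 𝒪-1)))
              -- 1 = (1 - tᵉ) + tᵉ with both summands in M; again e ≥ 1 exhibits t as a factor of
              -- tᵉ.
              1∈M = M.resp (solve 2 (λ i u → (i :- u) :+ u := i) refl 1# (t ^ suc period))
                      (M.+-closed (Q⊆M 1-t^e∈Q)
                        (M.resp (*-comm _ _) (M.*-closed (A⊆𝒪 (A-^ A-t period)) t∈M)))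
          in Max.proper λ {x} x∈𝒪 → M.resp (*-identityʳ x) (M.*-closed x∈𝒪 1∈M)

open import Data.Nat.Base using (_^_)

theorem3p1 :
    ∀ {c ℓ₁ ℓ₂} (E : ExtensionOfℚ c ℓ₁ ℓ₂) →
    let
      open ExtensionOfℚ E
    in
    (n : ℕ) (f : ℤ[X]) → 2 ≤ n → MonicOfDegree n f → Irreducible f →
    (θ : Carrier) → eval f θ ≈ 0# →
    let
      open NumberField E θ
    in
    (p : ℕ) → Prime p → (r : ℤ) →
    ¬ (+ (p ^ 2) ∣ evalℤ f r) →
    ¬ (+ p ∣ evalℤ (derivative (derivative f)) r) →
    (∀ M → IsMaximalIdeal M → Conductor ⊆ M → fromInt (+ p) ∈ M →
      θ - fromInt r ∈ M) →
    p -Maximal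
theorem3p1 E n f _ f-monic _ θ fθ≈0 p p-prime r p²∤fr _ t∈all N index =
  Index.FiniteIndex.p-maximal E θ n
    -- The equation f(θ) = 0 with f monic is the integral relation for θ on which the construction
    -- rests.
    (Poly-resp E fθ≈0 (eval-Poly E f f-monic)) N index p p-prime f fθ≈0 r p²∤fr t∈all
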